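{- Let $G$ be a connected weighted graph of order $n\ge3$ and let $\mathcal P=\{V_1,\dots,V_m\}$ be a partition of $V(G)$ into $m$ nonempty parts, where $2\le m\le n-1$. Then $$K(G)\ \ge\ F_m\bigl(\operatorname{NCut}(\mathcal P)\bigr),\qquad\text{where}\quad F_m(x)=\frac{(m-1)^2}{x}+\frac{(n-m)^2}{n-x}\quad(0<x<n).$$
   Context: Graphs are finite, simple, connected, undirected and weighted: $G=(V,E,c)$ with symmetric weights $c(i,j)=c_{ij}=c_{ji}>0$ if $\{i,j\}\in E$ and $c_{ij}=0$ otherwise (no loops), $|V|=n$. The degree of vertex $i$ is $k_i=\sum_j c_{ij}$, $D=\operatorname{diag}(k_1,\dots,k_n)$, $A=(c_{ij})$ is the adjacency matrix. For $S\subseteq V$ with complement $\bar S$, $\operatorname{vol}(S)=\sum_{i\in S}k_i$ and $\operatorname{cut}(S,\bar S)=\sum_{u\in S,v\in\bar S}c_{uv}$. The normalized cut of the partition is $\operatorname{NCut}(\mathcal P)=\sum_{i=1}^m\frac{\operatorname{cut}(V_i,\bar V_i)}{\operatorname{vol}(V_i)}$. The normalized adjacency matrix is $M_G=D^{ -1/2}AD^{ -1/2}$, with eigenvalues $1=\lambda_1>\lambda_2\ge\cdots\ge\lambda_n\ge-1$. Kemeny's constant is $K(G)=\sum_i\pi_i m_{ji}-1$ for the random walk with transition matrix $D^{ -1}A$, where $\pi$ is the stationary distribution and $m_{ji}$ the mean first passage time from $j$ to $i$ (with $m_{jj}$ the mean first return time); this does not depend on $j$, and it is known that $K(G)=\sum_{j=2}^{n}\frac{1}{1-\lambda_j}$.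 -}

module Defs where

open import Level using (Level; _⊔_) renaming (suc to lsuc)
open import Algebra.Bundles using (CommutativeRing; Semiring)
open import Algebra.Core using (Op₁)
import Algebra.Definitions.RawMonoid as RawMonoidDefs
import Algebra.Definitions.RawSemiring as RawSemiringDefs
open import Data.Bool.Base using (if_then_else_)
open import Data.Fin.Base using (Fin; toℕ)
open import Data.Fin.Subset using (Subset; Nonempty; Empty; _∈_; _∩_; ∁; ⁅_⁆)
open import Data.Nat.Base using (ℕ; zero; suc) renaming (_≤_ to _≤ℕ_)
open import Data.Product.Base using (∃; _×_)
open import Data.Vec.Base using (lookup)
open import Data.Vec.Functional using (Vector)
open import Function.Base using (_∘_)
open import Relation.Binary.Core using (Rel)
open import Relation.Binary.Construct.Closure.ReflexiveTransitive using (Star)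
import Relation.Binary.Construct.NonStrictToStrict as ToStrict
open import Relation.Binary.PropositionalEquality.Core using (_≢_)
open import Relation.Binary.Structures using (IsDecTotalOrder)

-- The real numbers of classical mathematics are an instance; ordered fields
-- in general stand in for them, since the library has no real numbers.
-- The value of 0# ⁻¹ is left unspecified.
record OrderedField (c ℓ₁ ℓ₂ : Level) : Set (lsuc (c ⊔ ℓ₁ ⊔ ℓ₂)) where
  infix 8 _⁻¹
  infixl 7 _/_
  infix 4 _≤_
  field
    commutativeRing : CommutativeRing c ℓ₁
  open CommutativeRing commutativeRing public
  field
    0≉1             : 0# ≉ 1#
    _⁻¹             : Op₁ Carrier
    ⁻¹-cong         : ∀ {x y} → x ≈ y → x ⁻¹ ≈ y ⁻¹
    ⁻¹-inverseʳ     : ∀ {x} → x ≉ 0# → x * x ⁻¹ ≈ 1#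
    _≤_             : Rel Carrier ℓ₂
    isDecTotalOrder : IsDecTotalOrder _≈_ _≤_
    +-monoʳ-≤       : ∀ {x y} z → x ≤ y → z + x ≤ z + y
    *-nonNeg        : ∀ {x y} → 0# ≤ x → 0# ≤ y → 0# ≤ x * y

  open ToStrict _≈_ _≤_ public using (_<_)

  _/_ : Carrier → Carrier → Carrier
  x / y = x * y ⁻¹

module OverField {c ℓ₁ ℓ₂} (R : OrderedField c ℓ₁ ℓ₂) where

  open OrderedField R
  open RawMonoidDefs +-rawMonoid using (sum) renaming (_×_ to _×#_)
  open RawSemiringDefs (Semiring.rawSemiring semiring) using (_^_)

  fromℕ : ℕ → Carrier
  fromℕ n = n ×# 1#

  sumOver : ∀ {n} → Subset n → Vector Carrier n → Carrier
  sumOver S f = sum λ i → if lookup S i then f i else 0#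

  HasSum : (ℕ → Carrier) → Carrier → Set (c ⊔ ℓ₁ ⊔ ℓ₂)
  HasSum a s = ∀ ε → 0# < ε → ∃ λ N → ∀ M → N ≤ℕ M →
    s - ε < partialSum M × partialSum M < s + ε
    where
    partialSum : ℕ → Carrier
    partialSum M = sum {M} (a ∘ toℕ)

  -- The vertex set is Fin n.  The weights determine the edge set:
  -- {i , j} is an edge exactly when the weight of i j is positive.
  record WeightedGraph (n : ℕ) : Set (c ⊔ ℓ₁ ⊔ ℓ₂) where
    field
      weight     : Fin n → Fin n → Carrier
      symmetric  : ∀ i j → weight i j ≈ weight j i
      nonNeg     : ∀ i j → 0# ≤ weight i j
      loopless   : ∀ i → weight i i ≈ 0#

    Edge : Rel (Fin n) (ℓ₁ ⊔ ℓ₂)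
    Edge i j = 0# < weight i j

    field
      connected : ∀ i j → Star Edge i j

  record IsPartition {n m} (V : Fin m → Subset n) : Set where
    field
      nonempty : ∀ a → Nonempty (V a)
      disjoint : ∀ a b → a ≢ b → Empty (V a ∩ V b)
      covering : ∀ i → ∃ λ a → i ∈ V a

  module _ {n} (G : WeightedGraph n) where
    open WeightedGraph G

    degree : Fin n → Carrier
    degree i = sum λ j → weight i j

    vol : Subset n → Carrier
    vol S = sumOver S degree

    cut : Subset n → Subset n → Carrier
    cut S T = sumOver S λ u → sumOver T λ v → weight u v

    NCut : ∀ {m} → (Fin m → Subset n) → Carrier
    NCut V = sum λ a → cut (V a) (∁ (V a)) / vol (V a)

    transition : Fin n → Fin n → Carrier
    transition i j = weight i j / degree i

    record IsStationary (π : Vector Carrier n) : Set (ℓ₁ ⊔ ℓ₂) where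
      field
        nonNegative : ∀ i → 0# ≤ π i
        total       : sum π ≈ 1#
        invariant   : ∀ j → sum (λ i → π i * transition i j) ≈ π j

    -- firstPassage t j i is the probability that the walk started at j is at i
    -- at time t, and at no time s with 1 ≤ s < t.
    firstPassage : ℕ → Fin n → Fin n → Carrier
    firstPassage zero          j i = 0#
    firstPassage (suc zero)    j i = transition j i
    firstPassage (suc (suc t)) j i =
      sumOver (∁ ⁅ i ⁆) λ k → transition j k * firstPassage (suc t) k i

    -- The expectation of the first time t ≥ 1 at which the walk started at j
    -- is at i; for j = i this is the mean first return time.
    IsMeanFirstPassageTime : Fin n → Fin n → Carrier → Set (c ⊔ ℓ₁ ⊔ ℓ₂)
    IsMeanFirstPassageTime j i = HasSum λ t → fromℕ t * firstPassage t j i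

  -- Kemeny's constant, computed from the starting vertex j, in terms of the
  -- stationary distribution and the mean first passage times.
  kemeny : ∀ {n} → Vector Carrier n → (Fin n → Fin n → Carrier) → Fin n → Carrier
  kemeny π μ j = sum (λ i → π i * μ j i) - 1#

  -- Meaningful for 0# < x < fromℕ n.
  F : ℕ → ℕ → Carrier → Carrier
  F n m x = (fromℕ m - 1#) ^ 2 / x + (fromℕ n - fromℕ m) ^ 2 / (fromℕ n - x)

{-# OPTIONS --safe #-}

-- Kemeny's constant is the trace of the Green's function of the walk, so it can
-- be handled without eigenvalues.  Write E for the Dirichlet form of the weights,
-- k for the degrees, δᵢ for the indicator of {i}, and γᵢ for a solution of
-- Δ γᵢ = kᵢ (δᵢ - π); the mean first passage times to i provide one.  For a
-- partition V into m parts let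
--
--   energy s V = ∑ₐ E (s χₐ - Γₐ) / vol Vₐ,   χₐ = ∑_{i ∈ Vₐ} δᵢ,  Γₐ = ∑_{i ∈ Vₐ} γᵢ
--              = s² NCut V - 2 s (m - 1) + ∑ₐ E (Γₐ) / vol Vₐ.
--
-- The partition into singletons has NCut = n, and there the last sum is K.  Now
-- energy s V ≥ 0, and by convexity of E energy t V is at most the energy of the
-- singletons at t.  Adding the two inequalities gives, for all s and t,
--
--   (2 s (m - 1) - s² NCut V) + (2 t (n - m) - t² (n - NCut V)) ≤ K,
--
-- and maximizing over s and t yields F.
module Submission where

open import Algebra.Bundles using (CommutativeRing; RawRing)
import Algebra.Properties.AbelianGroup as AbelianGroupProperties
import Algebra.Properties.Ring as RingProperties
import Algebra.Properties.Semiring.Mult.TCOptimised as Mult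
import Algebra.Properties.Semiring.Sum as SemiringSum
import Algebra.Solver.Ring as RingSolver
open import Algebra.Solver.Ring.AlmostCommutativeRing using (_-Raw-AlmostCommutative⟶_; fromCommutativeRing)
open import Data.Bool.Base using (true; false; if_then_else_)
open import Data.Fin.Base using (Fin; zero; suc; toℕ)
open import Data.Fin.Properties using (suc-injective)
open import Data.Fin.Subset using (Subset; Nonempty; _∈_; _∉_; _∩_; ∁; ⁅_⁆)
open import Data.Fin.Subset.Properties using (_∈?_; x∈⁅x⁆; x∈⁅y⁆⇒x≡y; x∈p∩q⁺; x∈p∩q⁻; x∉p⇒x∈∁p; x∈p⇒x∉∁p)
open import Data.Integer.Base as ℤ using (ℤ; +_; -[1+_]; _⊖_)
import Data.Integer.Properties as ℤ
open import Data.Maybe.Base using (Maybe; just; nothing)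
open import Data.Nat.Base as ℕ using (ℕ; zero; suc; _∸_; _⊔_; s≤s; z≤n) renaming (_≤_ to _≤ℕ_; _<_ to _<ℕ_)
import Data.Nat.Properties as ℕ
open import Data.Product.Base using (∃; _×_; _,_; proj₁; proj₂)
open import Data.Sum.Base using (inj₁; inj₂)
open import Data.Vec.Base using (lookup)
open import Data.Vec.Functional using (Vector)
open import Data.Vec.Properties using ([]=⇒lookup; lookup⇒[]=)
open import Function.Base using (_∘_; _$_)
open import Level using () renaming (_⊔_ to _⊔ˡ_)
open import Relation.Binary.Bundles using (Poset)
open import Relation.Binary.Construct.Closure.ReflexiveTransitive as Star using (Star; _◅_)
open import Relation.Binary.PropositionalEquality.Core as ≡ using (_≡_; _≢_)
import Relation.Binary.Reasoning.PartialOrder as PartialOrderReasoning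
import Relation.Binary.Reasoning.Setoid as SetoidReasoning
open import Relation.Binary.Structures using (IsDecTotalOrder)
open import Relation.Nullary.Decidable.Core using (yes; no)
open import Relation.Nullary.Negation.Core using (¬_; contradiction)
open import Defs

-- Integer coefficients let the solver recognize cancellation over a ring whose
-- equality does not compute.

-- Behind the two energy inequalities stand two trace inequalities. Let `L = I - M_G` be the
-- normalized Laplacian, `L⁺` its pseudoinverse, and `Π` the orthogonal projection onto the span of
-- the vectors `D^(1/2) χₐ`. Then `NCut V` is the trace of `Π L`, the Green energy of `V` is the
-- trace of `Π L⁺`, and `energy s V` is the trace of `Π (s L^(1/2) - (L⁺)^(1/2))²`. The range of `Π`
-- has dimension `m` and contains the kernel of `L`, so the cross term counts `m - 1` dimensions.
-- The orthogonal complement has dimension `n - m`, and `L` has trace `n - NCut V` there; the gap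
-- between singletons and `V` is the trace over this complement. Uniqueness of solutions comes from
-- connectivity: a function of zero energy is constant. That the walk reaches its target with
-- probability 1 is extracted from the convergence of the mean first passage times.

module IntegerCoefficients {r₁ r₂} (R : CommutativeRing r₁ r₂) where

  open CommutativeRing R
  open AbelianGroupProperties +-abelianGroup
    using (⁻¹-involutive; ⁻¹-∙-comm; ε⁻¹≈ε; xyx⁻¹≈y)
  open RingProperties ring using (-‿distribˡ-*; -‿distribʳ-*)
  open Mult semiring using (1+×; ×-homo-+; ×1-homo-*) renaming (_×_ to _ו_)
  open SetoidReasoning setoid

  ⟦_⟧ : ℤ → Carrier
  ⟦ + n ⟧      = n ו 1#
  ⟦ -[1+ n ] ⟧ = - (suc n ו 1#)

  neg-homo : ∀ i → ⟦ ℤ.- i ⟧ ≈ - ⟦ i ⟧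
  neg-homo (+ zero)  = sym ε⁻¹≈ε
  neg-homo (+ suc n) = refl
  neg-homo -[1+ n ]  = sym (⁻¹-involutive _)

  ⊖-homo : ∀ m n → ⟦ m ⊖ n ⟧ ≈ m ו 1# - n ו 1#
  ⊖-homo m zero = sym (trans (+-congˡ ε⁻¹≈ε) (+-identityʳ _))
  ⊖-homo zero (suc n) = sym (+-identityˡ _)
  ⊖-homo (suc m) (suc n) = begin
    ⟦ suc m ⊖ suc n ⟧                        ≡⟨ ≡.cong ⟦_⟧ (ℤ.[1+m]⊖[1+n]≡m⊖n m n) ⟩
    ⟦ m ⊖ n ⟧                                ≈⟨ ⊖-homo m n ⟩
    m ו 1# - n ו 1#                        ≈⟨ +-congʳ (xyx⁻¹≈y 1# (m ו 1#)) ⟨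
    1# + m ו 1# - 1# - n ו 1#              ≈⟨ +-assoc _ _ _ ⟩
    1# + m ו 1# + (- 1# - n ו 1#)          ≈⟨ +-congˡ (⁻¹-∙-comm 1# (n ו 1#)) ⟩
    1# + m ו 1# - (1# + n ו 1#)            ≈⟨ +-cong (1+× m 1#) (-‿cong (1+× n 1#)) ⟨
    suc m ו 1# - suc n ו 1#                ∎

  add-homo : ∀ i j → ⟦ i ℤ.+ j ⟧ ≈ ⟦ i ⟧ + ⟦ j ⟧
  add-homo (+ m)    (+ n)    = ×-homo-+ 1# m n
  add-homo (+ m)    -[1+ n ] = ⊖-homo m (suc n)
  add-homo -[1+ m ] (+ n)    = trans (⊖-homo n (suc m)) (+-comm _ _)
  add-homo -[1+ m ] -[1+ n ] = begin
    - (suc (suc (m ℕ.+ n)) ו 1#)       ≡⟨ ≡.cong (λ k → - (suc k ו 1#)) (ℕ.+-suc m n) ⟨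
    - ((suc m ℕ.+ suc n) ו 1#)         ≈⟨ -‿cong (×-homo-+ 1# (suc m) (suc n)) ⟩
    - (suc m ו 1# + suc n ו 1#)       ≈⟨ ⁻¹-∙-comm _ _ ⟨
    - (suc m ו 1#) - suc n ו 1#       ∎

  mul-homo : ∀ i j → ⟦ i ℤ.* j ⟧ ≈ ⟦ i ⟧ * ⟦ j ⟧
  mul-homo (+ m) (+ n) = begin
    ⟦ + m ℤ.* + n ⟧      ≡⟨ ≡.cong ⟦_⟧ (ℤ.+◃n≡+n (m ℕ.* n)) ⟩
    (m ℕ.* n) ו 1#      ≈⟨ ×1-homo-* m n ⟩
    m ו 1# * n ו 1#    ∎
  mul-homo (+ m) -[1+ n ] = begin
    ⟦ + m ℤ.* -[1+ n ] ⟧          ≡⟨ ≡.cong ⟦_⟧ (ℤ.-◃n≡-n (m ℕ.* suc n)) ⟩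
    ⟦ ℤ.- (+ (m ℕ.* suc n)) ⟧     ≈⟨ neg-homo (+ (m ℕ.* suc n)) ⟩
    - ((m ℕ.* suc n) ו 1#)       ≈⟨ -‿cong (×1-homo-* m (suc n)) ⟩
    - (m ו 1# * suc n ו 1#)     ≈⟨ -‿distribʳ-* _ _ ⟩
    m ו 1# * - (suc n ו 1#)     ∎
  mul-homo -[1+ m ] (+ n) = begin
    ⟦ -[1+ m ] ℤ.* + n ⟧          ≡⟨ ≡.cong ⟦_⟧ (ℤ.-◃n≡-n (suc m ℕ.* n)) ⟩
    ⟦ ℤ.- (+ (suc m ℕ.* n)) ⟧     ≈⟨ neg-homo (+ (suc m ℕ.* n)) ⟩
    - ((suc m ℕ.* n) ו 1#)       ≈⟨ -‿cong (×1-homo-* (suc m) n) ⟩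
    - (suc m ו 1# * n ו 1#)     ≈⟨ -‿distribˡ-* _ _ ⟩
    - (suc m ו 1#) * n ו 1#     ∎
  mul-homo -[1+ m ] -[1+ n ] = begin
    (suc m ℕ.* suc n) ו 1#                ≈⟨ ×1-homo-* (suc m) (suc n) ⟩
    suc m ו 1# * suc n ו 1#              ≈⟨ ⁻¹-involutive _ ⟨
    - - (suc m ו 1# * suc n ו 1#)        ≈⟨ -‿cong (-‿distribʳ-* _ _) ⟩
    - (suc m ו 1# * - (suc n ו 1#))      ≈⟨ -‿distribˡ-* _ _ ⟩
    - (suc m ו 1#) * - (suc n ו 1#)      ∎

  ℤ-rawRing : RawRing _ _
  ℤ-rawRing = record
    { Carrier = ℤ ; _≈_ = _≡_ ; _+_ = ℤ._+_ ; _*_ = ℤ._*_ ; -_ = ℤ.-_ ; 0# = + 0 ; 1# = + 1 }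

  homomorphism : ℤ-rawRing -Raw-AlmostCommutative⟶ fromCommutativeRing R
  homomorphism = record
    { ⟦_⟧    = ⟦_⟧
    ; +-homo = add-homo
    ; *-homo = mul-homo
    ; -‿homo = neg-homo
    ; 0-homo = refl
    ; 1-homo = refl
    }

  equal? : ∀ i j → Maybe (⟦ i ⟧ ≈ ⟦ j ⟧)
  equal? i j with i ℤ.≟ j
  ... | yes i≡j = just (reflexive (≡.cong ⟦_⟧ i≡j))
  ... | no _    = nothing

  open RingSolver ℤ-rawRing (fromCommutativeRing R) homomorphism equal? public
    using (Polynomial; solve; con; _:=_; _:+_; _:*_; _:-_; :-_)

-- Arithmetic of ordered fields and finite sums.

module OrderedFieldProperties {c ℓ₁ ℓ₂} (R : OrderedField c ℓ₁ ℓ₂) where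

  open OrderedField R public hiding (zero)
  open IsDecTotalOrder isDecTotalOrder public
    using (_≟_; _≤?_; isPartialOrder)
    renaming (refl to ≤-refl; reflexive to ≤-reflexive; trans to ≤-trans; antisym to ≤-antisym;
        total to ≤-total)
  open IntegerCoefficients commutativeRing public
    using (Polynomial; solve; con; _:=_; _:+_; _:*_; _:-_; :-_)
  private module Sum = SemiringSum semiring
  open OverField R public using (fromℕ)

  poset : Poset c ℓ₁ ℓ₂
  poset = record { isPartialOrder = isPartialOrder }

  module ≤-Reasoning = PartialOrderReasoning poset

  :0 :1 : ∀ {n} → Polynomial n
  :0 = con (+ 0)
  :1 = con (+ 1)

  ≤⇒0≤ : ∀ {x y} → x ≤ y → 0# ≤ y - x
  ≤⇒0≤ {x} {y} x≤y = begin
    0#        ≈⟨ solve 1 (λ x → :0 := :- x :+ x) refl x ⟩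
    - x + x   ≤⟨ +-monoʳ-≤ (- x) x≤y ⟩
    - x + y   ≈⟨ +-comm (- x) y ⟩
    y - x     ∎
    where open ≤-Reasoning

  0≤⇒≤ : ∀ {x y e} → 0# ≤ e → y ≈ x + e → x ≤ y
  0≤⇒≤ {x} {y} {e} 0≤e y≈x+e = begin
    x        ≈⟨ +-identityʳ x ⟨
    x + 0#   ≤⟨ +-monoʳ-≤ x 0≤e ⟩
    x + e    ≈⟨ y≈x+e ⟨
    y        ∎
    where open ≤-Reasoning

  ≈⇒diff≈0 : ∀ {x y} → x ≈ y → x - y ≈ 0#
  ≈⇒diff≈0 {x} {y} x≈y = trans (+-congʳ x≈y) (-‿inverseʳ y)

  diff≈0⇒≈ : ∀ {x y} → x - y ≈ 0# → x ≈ y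
  diff≈0⇒≈ {x} {y} x-y≈0 = begin-equality
    x           ≈⟨ solve 2 (λ x y → x := (x :- y) :+ y) refl x y ⟩
    x - y + y   ≈⟨ +-congʳ x-y≈0 ⟩
    0# + y      ≈⟨ +-identityˡ y ⟩
    y           ∎
    where open ≤-Reasoning

  <⇒0< : ∀ {x y} → x < y → 0# < y - x
  <⇒0< (x≤y , x≉y) = ≤⇒0≤ x≤y , λ 0≈y-x → x≉y (sym (diff≈0⇒≈ (sym 0≈y-x)))

  0<⇒< : ∀ {x y e} → 0# < e → y ≈ x + e → x < y
  0<⇒< {x} {y} {e} (0≤e , 0≉e) y≈x+e = 0≤⇒≤ 0≤e y≈x+e , λ x≈y → 0≉e $ begin-equality
    0#         ≈⟨ ≈⇒diff≈0 (sym x≈y) ⟨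
    y - x      ≈⟨ +-congʳ y≈x+e ⟩
    x + e - x  ≈⟨ solve 2 (λ x e → x :+ e :- x := e) refl x e ⟩
    e          ∎
    where open ≤-Reasoning

  ≰⇒> : ∀ {x y} → ¬ x ≤ y → y < x
  ≰⇒> {x} {y} x≰y with ≤-total x y
  ... | inj₁ x≤y = contradiction x≤y x≰y
  ... | inj₂ y≤x = y≤x , λ y≈x → x≰y (≤-reflexive (sym y≈x))

  <⇒≱ : ∀ {x y} → x < y → ¬ y ≤ x
  <⇒≱ (x≤y , x≉y) y≤x = x≉y (≤-antisym x≤y y≤x)

  pos⇒≉0 : ∀ {x} → 0# < x → x ≉ 0#
  pos⇒≉0 (_ , 0≉x) x≈0 = 0≉x (sym x≈0)

  +-nonNeg : ∀ {x y} → 0# ≤ x → 0# ≤ y → 0# ≤ x + y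
  +-nonNeg 0≤x 0≤y = ≤-trans 0≤x (0≤⇒≤ 0≤y refl)

  +-nonNeg-pos : ∀ {x y} → 0# ≤ x → 0# < y → 0# < x + y
  +-nonNeg-pos {x} {y} 0≤x 0<y = begin-strict
    0#     ≤⟨ 0≤x ⟩
    x      <⟨ 0<⇒< 0<y refl ⟩
    x + y  ∎
    where open ≤-Reasoning

  +-pos-nonNeg : ∀ {x y} → 0# < x → 0# ≤ y → 0# < x + y
  +-pos-nonNeg {x} {y} 0<x 0≤y = begin-strict
    0#     <⟨ 0<x ⟩
    x      ≤⟨ 0≤⇒≤ 0≤y refl ⟩
    x + y  ∎
    where open ≤-Reasoning

  +-mono-≤ : ∀ {x y u v} → x ≤ y → u ≤ v → x + u ≤ y + v
  +-mono-≤ {x} {y} {u} {v} x≤y u≤v = 0≤⇒≤ (+-nonNeg (≤⇒0≤ x≤y) (≤⇒0≤ u≤v))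
    (solve 4 (λ x y u v → y :+ v := x :+ u :+ ((y :- x) :+ (v :- u))) refl x y u v)

  +-mono-< : ∀ {x y u v} → x < y → u < v → x + u < y + v
  +-mono-< {x} {y} {u} {v} x<y u<v = 0<⇒< (+-nonNeg-pos (proj₁ (<⇒0< x<y)) (<⇒0< u<v))
    (solve 4 (λ x y u v → y :+ v := x :+ u :+ ((y :- x) :+ (v :- u))) refl x y u v)

  square-nonNeg : ∀ x → 0# ≤ x * x
  square-nonNeg x with ≤-total 0# x
  ... | inj₁ 0≤x = *-nonNeg 0≤x 0≤x
  ... | inj₂ x≤0 = begin
    0#                     ≤⟨ *-nonNeg (≤⇒0≤ x≤0) (≤⇒0≤ x≤0) ⟩
    (0# - x) * (0# - x)    ≈⟨ solve 1 (λ x → (:0 :- x) :* (:0 :- x) := x :* x) refl x ⟩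
    x * x                  ∎
    where open ≤-Reasoning

  0<1 : 0# < 1#
  0<1 = ≤-trans (square-nonNeg 1#) (≤-reflexive (*-identityʳ 1#)) , 0≉1

  x*y≈0⇒y≈0 : ∀ {x y} → x ≉ 0# → x * y ≈ 0# → y ≈ 0#
  x*y≈0⇒y≈0 {x} {y} x≉0 xy≈0 = begin-equality
    y                 ≈⟨ *-identityˡ y ⟨
    1# * y            ≈⟨ *-congʳ (⁻¹-inverseʳ x≉0) ⟨
    x * x ⁻¹ * y      ≈⟨ solve 3 (λ x z y → x :* z :* y := z :* (x :* y)) refl x (x ⁻¹) y ⟩
    x ⁻¹ * (x * y)    ≈⟨ *-congˡ xy≈0 ⟩
    x ⁻¹ * 0#         ≈⟨ zeroʳ _ ⟩
    0#                ∎
    where open ≤-Reasoning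

  x*x≈0⇒x≈0 : ∀ {x} → x * x ≈ 0# → x ≈ 0#
  x*x≈0⇒x≈0 {x} xx≈0 with x ≟ 0#
  ... | yes x≈0 = x≈0
  ... | no  x≉0 = x*y≈0⇒y≈0 x≉0 xx≈0

  *-pos : ∀ {x y} → 0# < x → 0# < y → 0# < x * y
  *-pos 0<x (0≤y , 0≉y) =
    *-nonNeg (proj₁ 0<x) 0≤y , λ 0≈xy → 0≉y (sym (x*y≈0⇒y≈0 (pos⇒≉0 0<x) (sym 0≈xy)))

  ⁻¹-pos : ∀ {x} → 0# < x → 0# < x ⁻¹
  ⁻¹-pos {x} 0<x = ≰⇒> λ x⁻¹≤0 → <⇒≱ 0<1 $ 0≤⇒≤ (*-nonNeg (proj₁ 0<x) (≤⇒0≤ x⁻¹≤0)) $ begin-equality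
    0#
      ≈⟨ solve 2 (λ x y → :0 := x :* y :+ x :* (:0 :- y)) refl x (x ⁻¹) ⟩
    x * x ⁻¹ + x * (0# - x ⁻¹)        ≈⟨ +-congʳ (⁻¹-inverseʳ (pos⇒≉0 0<x)) ⟩
    1# + x * (0# - x ⁻¹)              ∎
    where open ≤-Reasoning

  *-monoʳ-≤ : ∀ {x y z} → 0# ≤ z → x ≤ y → z * x ≤ z * y
  *-monoʳ-≤ {x} {y} {z} 0≤z x≤y = 0≤⇒≤ (*-nonNeg 0≤z (≤⇒0≤ x≤y))
    (solve 3 (λ x y z → z :* y := z :* x :+ z :* (y :- x)) refl x y z)

  x*[y/x] : ∀ {x} y → 0# < x → x * (y / x) ≈ y
  x*[y/x] {x} y 0<x = begin-equality
    x * (y * x ⁻¹)   ≈⟨ solve 3 (λ x y z → x :* (y :* z) := y :* (x :* z)) refl x y (x ⁻¹) ⟩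
    y * (x * x ⁻¹)   ≈⟨ *-congˡ (⁻¹-inverseʳ (pos⇒≉0 0<x)) ⟩
    y * 1#           ≈⟨ *-identityʳ y ⟩
    y                ∎
    where open ≤-Reasoning

  -- If q ≤ 0 the parabola in s would be unbounded above; otherwise its maximum
  -- is attained at s = p / q.
  parabola-bound : ∀ {p q C} → 0# < p → (∀ s → (1# + 1#) * s * p - s * s * q ≤ C) → p * p / q ≤ C
  parabola-bound {p} {q} {C} 0<p bound with q ≤? 0#
  ... | no q≰0 = begin
    p * p / q
      ≈⟨ solve 2 (λ p q⁻¹ → p :* p :* q⁻¹ := (:1 :+ :1) :* (p :* q⁻¹) :* p :- (p :* q⁻¹) :* p)
          refl p (q ⁻¹) ⟩
    (1# + 1#) * s * p - s * p                    ≈⟨ +-congˡ (-‿cong (*-congˡ (x*[y/x] p 0<q))) ⟨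
    (1# + 1#) * s * p - s * (q * s)
      ≈⟨ +-congˡ (-‿cong (solve 2 (λ s q → s :* (q :* s) := s :* s :* q) refl s q)) ⟩
    (1# + 1#) * s * p - s * s * q                ≤⟨ bound s ⟩
    C                                            ∎
    where
    open ≤-Reasoning
    0<q = ≰⇒> q≰0
    s = p / q
  ... | yes q≤0 = contradiction C+1≤C (<⇒≱ (0<⇒< 0<1 refl))
    where
    open ≤-Reasoning
    0<2p : 0# < (1# + 1#) * p
    0<2p = *-pos (+-nonNeg-pos (proj₁ 0<1) 0<1) 0<p
    -- Chosen so that the linear term alone equals `C + 1#`; since `q ≤ 0`, the quadratic term can
    -- only add to it.
    s = (C + 1#) / ((1# + 1#) * p)
    C+1≤C : C + 1# ≤ C
    C+1≤C = begin
      C + 1#                            ≈⟨ x*[y/x] (C + 1#) 0<2p ⟨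
      (1# + 1#) * p * s
        ≤⟨ 0≤⇒≤ (*-nonNeg (square-nonNeg s) (≤⇒0≤ q≤0))
            (solve 3 (λ p q s → (:1 :+ :1) :* s :* p :- s :* s :* q := (:1 :+ :1) :* p :* s
                :+ s :* s :* (:0 :- q)) refl p q s) ⟩
      (1# + 1#) * s * p - s * s * q     ≤⟨ bound s ⟩
      C                                 ∎

  -- Sealing the sum keeps its length inferable: the library's sum unfolds by
  -- recursion on the length and so is not injective for unification.
  opaque
    ∑ : ∀ {n} → Vector Carrier n → Carrier
    ∑ = Sum.sum

    ∑≈sum : ∀ {n} (f : Vector Carrier n) → ∑ f ≈ Sum.sum f
    ∑≈sum f = refl

    ∑-cong : ∀ {n} {f g : Vector Carrier n} → (∀ i → f i ≈ g i) → ∑ f ≈ ∑ g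
    ∑-cong = Sum.sum-cong-≋

    ∑-distrib-+ : ∀ {n} (f g : Vector Carrier n) → ∑ (λ i → f i + g i) ≈ ∑ f + ∑ g
    ∑-distrib-+ = Sum.∑-distrib-+

    ∑-swap : ∀ {m n} (f : Fin m → Vector Carrier n) → ∑ (λ i → ∑ (f i)) ≈ ∑ (λ j → ∑ (λ i → f i j))
    ∑-swap = Sum.∑-comm

    *-distribˡ-∑ : ∀ {n} x (f : Vector Carrier n) → x * ∑ f ≈ ∑ (λ i → x * f i)
    *-distribˡ-∑ = Sum.*-distribˡ-sum

    ∑-1 : ∀ n → ∑ {n} (λ _ → 1#) ≈ fromℕ n
    ∑-1 n = Sum.sum-replicate n

    ∑-nonNeg : ∀ {n} {f : Vector Carrier n} → (∀ i → 0# ≤ f i) → 0# ≤ ∑ f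
    ∑-nonNeg {zero}  0≤f = ≤-refl
    ∑-nonNeg {suc n} 0≤f = +-nonNeg (0≤f zero) (∑-nonNeg (0≤f ∘ suc))

    term≤∑ : ∀ {n} {f : Vector Carrier n} → (∀ i → 0# ≤ f i) → ∀ i → f i ≤ ∑ f
    term≤∑ 0≤f zero    = 0≤⇒≤ (∑-nonNeg (0≤f ∘ suc)) refl
    term≤∑ 0≤f (suc i) = ≤-trans (term≤∑ (0≤f ∘ suc) i) (0≤⇒≤ (0≤f zero) (+-comm _ _))

    ∑-mono-≤ : ∀ {n} {f g : Vector Carrier n} → (∀ i → f i ≤ g i) → ∑ f ≤ ∑ g
    ∑-mono-≤ {zero}  f≤g = ≤-refl
    ∑-mono-≤ {suc n} f≤g = +-mono-≤ (f≤g zero) (∑-mono-≤ (f≤g ∘ suc))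

    ∑-zero : ∀ {n} {f : Vector Carrier n} → (∀ i → f i ≈ 0#) → ∑ f ≈ 0#
    ∑-zero {n} f≈0 = trans (∑-cong f≈0) (Sum.sum-replicate-zero n)

    ∑-supported : ∀ {n} (f : Vector Carrier n) i → (∀ j → j ≢ i → f j ≈ 0#) → ∑ f ≈ f i
    ∑-supported f zero    off = trans (+-congˡ (∑-zero λ j → off (suc j) λ ())) (+-identityʳ _)
    ∑-supported f (suc i) off = trans
      (+-cong (off zero λ ()) (∑-supported (f ∘ suc) i λ j j≢i → off (suc j) (j≢i ∘ suc-injective)))
      (+-identityˡ _)

  *-distribʳ-∑ : ∀ {n} x (f : Vector Carrier n) → ∑ f * x ≈ ∑ (λ i → f i * x)
  *-distribʳ-∑ x f = trans (*-comm _ _) (trans (*-distribˡ-∑ x f) (∑-cong λ i → *-comm _ _))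

  ∑-neg : ∀ {n} (f : Vector Carrier n) → ∑ (λ i → - f i) ≈ - ∑ f
  ∑-neg f = begin-equality
    ∑ (λ i → - f i)          ≈⟨ ∑-cong (λ i → solve 1 (λ x → :- x := :- :1 :* x) refl (f i)) ⟩
    ∑ (λ i → - 1# * f i)     ≈⟨ *-distribˡ-∑ (- 1#) f ⟨
    - 1# * ∑ f               ≈⟨ solve 1 (λ x → :- :1 :* x := :- x) refl (∑ f) ⟩
    - ∑ f                    ∎
    where open ≤-Reasoning

  ∑-distrib-- : ∀ {n} (f g : Vector Carrier n) → ∑ (λ i → f i - g i) ≈ ∑ f - ∑ g
  ∑-distrib-- f g = trans (∑-distrib-+ f (λ i → - g i)) (+-congˡ (∑-neg g))

  ∑≈0⇒≈0 : ∀ {n} {f : Vector Carrier n} → (∀ i → 0# ≤ f i) → ∑ f ≈ 0# → ∀ i → f i ≈ 0#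
  ∑≈0⇒≈0 0≤f ∑f≈0 i = ≤-antisym (≤-trans (term≤∑ 0≤f i) (≤-reflexive ∑f≈0)) (0≤f i)

-- Limits of sequences and first-step equations for passage times.

module Limits {c ℓ₁ ℓ₂} (R : OrderedField c ℓ₁ ℓ₂) where

  open OrderedFieldProperties R
  open OverField R using (HasSum)
  open ≤-Reasoning

  -- `HasSum` is the case of partial sums. First-step analysis also combines such partial sums
  -- linearly, so limits of arbitrary sequences are needed.
  Lim : (ℕ → Carrier) → Carrier → Set (c ⊔ˡ ℓ₁ ⊔ˡ ℓ₂)
  Lim a s = ∀ ε → 0# < ε → ∃ λ N → ∀ M → N ≤ℕ M → s - ε < a M × a M < s + ε

  <-resp-≈ : ∀ {x y u v} → x ≈ u → y ≈ v → x < y → u < v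
  <-resp-≈ {x} {y} {u} {v} x≈u y≈v x<y = begin-strict
    u  ≈⟨ x≈u ⟨
    x  <⟨ x<y ⟩
    y  ≈⟨ y≈v ⟩
    v  ∎

  Lim-cong : ∀ {a b s t} → (∀ M → a M ≈ b M) → s ≈ t → Lim a s → Lim b t
  Lim-cong a≈b s≈t a→s ε 0<ε with a→s ε 0<ε
  ... | N , close = N , λ M N≤M →
    <-resp-≈ (+-congʳ s≈t) (a≈b M) (proj₁ (close M N≤M)) ,
    <-resp-≈ (a≈b M) (+-congʳ s≈t) (proj₂ (close M N≤M))

  Lim-suc : ∀ {a s} → Lim a s → Lim (a ∘ suc) s
  Lim-suc a→s ε 0<ε with a→s ε 0<ε
  ... | N , close = N , λ M N≤M → close (suc M) (ℕ.m≤n⇒m≤1+n N≤M)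

  half : Carrier
  half = (1# + 1#) ⁻¹

  0<half : 0# < half
  0<half = ⁻¹-pos (+-nonNeg-pos (proj₁ 0<1) 0<1)

  half+half : half + half ≈ 1#
  half+half = begin-equality
    half + half         ≈⟨ solve 1 (λ x → x :+ x := (:1 :+ :1) :* x) refl half ⟩
    (1# + 1#) * half    ≈⟨ ⁻¹-inverseʳ (pos⇒≉0 (+-nonNeg-pos (proj₁ 0<1) 0<1)) ⟩
    1#                  ∎

  half*[x+x] : ∀ x → half * (x + x) ≈ x
  half*[x+x] x = begin-equality
    half * (x + x)      ≈⟨ solve 2 (λ h x → h :* (x :+ x) := (h :+ h) :* x) refl half x ⟩
    (half + half) * x   ≈⟨ *-congʳ half+half ⟩
    1# * x              ≈⟨ *-identityˡ x ⟩
    x                   ∎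

  Lim-const : ∀ x → Lim (λ _ → x) x
  Lim-const x ε 0<ε = 0 , λ _ _ → 0<⇒< 0<ε (solve 2 (λ x e → x := x :- e :+ e) refl x ε) , 0<⇒< 0<ε refl

  Lim-+ : ∀ {a b s t} → Lim a s → Lim b t → Lim (λ M → a M + b M) (s + t)
  Lim-+ {a} {b} {s} {t} a→s b→t ε 0<ε with a→s (half * ε) (*-pos 0<half 0<ε) | b→t (half * ε)
      (*-pos 0<half 0<ε)
  ... | N₁ , close₁ | N₂ , close₂ = N₁ ⊔ N₂ , λ M N≤M →
    let a-close = close₁ M (ℕ.≤-trans (ℕ.m≤m⊔n N₁ N₂) N≤M)
        b-close = close₂ M (ℕ.≤-trans (ℕ.m≤n⊔m N₁ N₂) N≤M)
    in <-resp-≈ lower refl (+-mono-< (proj₁ a-close) (proj₁ b-close)) ,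
       <-resp-≈ refl upper (+-mono-< (proj₂ a-close) (proj₂ b-close))
    where
    lower : s - half * ε + (t - half * ε) ≈ s + t - ε
    lower = begin-equality
      s - half * ε + (t - half * ε)
        ≈⟨ solve 4 (λ s t h e → s :- h :* e :+ (t :- h :* e) := s :+ t :- h :* (e :+ e))
            refl s t half ε ⟩
      s + t - half * (ε + ε)          ≈⟨ +-congˡ (-‿cong (half*[x+x] ε)) ⟩
      s + t - ε                       ∎
    upper : s + half * ε + (t + half * ε) ≈ s + t + ε
    upper = begin-equality
      s + half * ε + (t + half * ε)
        ≈⟨ solve 4 (λ s t h e → s :+ h :* e :+ (t :+ h :* e) := s :+ t :+ h :* (e :+ e))
            refl s t half ε ⟩
      s + t + half * (ε + ε)          ≈⟨ +-congˡ (half*[x+x] ε) ⟩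
      s + t + ε                       ∎

  Lim-neg : ∀ {a s} → Lim a s → Lim (λ M → - a M) (- s)
  Lim-neg {a} {s} a→s ε 0<ε with a→s ε 0<ε
  ... | N , close = N , λ M N≤M →
    0<⇒< (<⇒0< (proj₂ (close M N≤M)))
      (solve 3 (λ s e a → :- a := :- s :- e :+ (s :+ e :- a)) refl s ε (a M)) ,
    0<⇒< (<⇒0< (proj₁ (close M N≤M)))
      (solve 3 (λ s e a → :- s :+ e := :- a :+ (a :- (s :- e))) refl s ε (a M))

  -- The tolerance for `a` is `ε / (x + 1#)` because `x` may be zero; in `ε ≈ x * δ + δ` the surplus
  -- `δ` keeps the inequalities strict.
  Lim-* : ∀ {a s} x → 0# ≤ x → Lim a s → Lim (λ M → x * a M) (x * s)
  Lim-* {a} {s} x 0≤x a→s ε 0<ε with a→s (ε / (x + 1#)) (*-pos 0<ε (⁻¹-pos (+-nonNeg-pos 0≤x 0<1)))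
  ... | N , close = N , λ M N≤M → lower (proj₁ (close M N≤M)) , upper (proj₂ (close M N≤M))
    where
    δ = ε / (x + 1#)
    0<δ : 0# < δ
    0<δ = *-pos 0<ε (⁻¹-pos (+-nonNeg-pos 0≤x 0<1))
    ε≈xδ+δ : ε ≈ x * δ + δ
    ε≈xδ+δ = begin-equality
      ε               ≈⟨ x*[y/x] ε (+-nonNeg-pos 0≤x 0<1) ⟨
      (x + 1#) * δ    ≈⟨ solve 2 (λ x d → (x :+ :1) :* d := x :* d :+ d) refl x δ ⟩
      x * δ + δ       ∎
    lower : ∀ {y} → s - δ < y → x * s - ε < x * y
    lower {y} s-δ<y = begin-strict
      x * s - ε                      ≈⟨ +-congˡ (-‿cong ε≈xδ+δ) ⟩
      x * s - (x * δ + δ)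
        <⟨ 0<⇒< 0<δ (solve 3 (λ x s d → x :* (s :- d) := x :* s :- (x :* d :+ d) :+ d) refl x s δ) ⟩
      x * (s - δ)                    ≤⟨ *-monoʳ-≤ 0≤x (proj₁ s-δ<y) ⟩
      x * y                          ∎
    upper : ∀ {y} → y < s + δ → x * y < x * s + ε
    upper {y} y<s+δ = begin-strict
      x * y                          ≤⟨ *-monoʳ-≤ 0≤x (proj₁ y<s+δ) ⟩
      x * (s + δ)
        <⟨ 0<⇒< 0<δ (solve 3 (λ x s d → x :* s :+ (x :* d :+ d) := x :* (s :+ d) :+ d) refl x s δ) ⟩
      x * s + (x * δ + δ)            ≈⟨ +-congˡ ε≈xδ+δ ⟨
      x * s + ε                      ∎

  opaque
    unfolding ∑

    Lim-∑ : ∀ {n} (a : ℕ → Vector Carrier n) (s : Vector Carrier n) →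
            (∀ i → Lim (λ M → a M i) (s i)) → Lim (λ M → ∑ (a M)) (∑ s)
    Lim-∑ {zero}  a s a→s = Lim-const 0#
    Lim-∑ {suc n} a s a→s = Lim-+ (a→s zero) (Lim-∑ (λ M → a M ∘ suc) (s ∘ suc) (a→s ∘ suc))

  -- If `t < s`, the neighbourhoods of `s` and `t` whose radius is half the gap are disjoint, yet a
  -- late term of the sequence would lie in both.
  Lim⇒≤ : ∀ {a s t} → Lim a s → Lim a t → s ≤ t
  Lim⇒≤ {a} {s} {t} a→s a→t with s ≤? t
  ... | yes s≤t = s≤t
  ... | no  s≰t = contradiction (≤-reflexive upper≈lower) (<⇒≱ lower<upper)
    where
    ε = half * (s - t)
    0<ε : 0# < ε
    0<ε = *-pos 0<half (<⇒0< (≰⇒> s≰t))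
    N₁ = proj₁ (a→s ε 0<ε)
    N₂ = proj₁ (a→t ε 0<ε)
    lower<upper : s - ε < t + ε
    lower<upper = begin-strict
      s - ε         <⟨ proj₁ (proj₂ (a→s ε 0<ε) (N₁ ⊔ N₂) (ℕ.m≤m⊔n N₁ N₂)) ⟩
      a (N₁ ⊔ N₂)   <⟨ proj₂ (proj₂ (a→t ε 0<ε) (N₁ ⊔ N₂) (ℕ.m≤n⊔m N₁ N₂)) ⟩
      t + ε         ∎
    upper≈lower : t + ε ≈ s - ε
    upper≈lower = begin-equality
      t + ε
        ≈⟨ solve 2 (λ t e → t :+ e := t :+ (e :+ e) :- e) refl t ε ⟩
      t + (ε + ε) - ε
        ≈⟨ +-congʳ (+-congˡ (distribˡ half (s - t) (s - t))) ⟨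
      t + half * (s - t + (s - t)) - ε         ≈⟨ +-congʳ (+-congˡ (half*[x+x] (s - t))) ⟩
      t + (s - t) - ε
        ≈⟨ solve 3 (λ s t e → t :+ (s :- t) :- e := s :- e) refl s t ε ⟩
      s - ε ∎

  Lim-unique : ∀ {a s t} → Lim a s → Lim a t → s ≈ t
  Lim-unique a→s a→t = ≤-antisym (Lim⇒≤ a→s a→t) (Lim⇒≤ a→t a→s)

  apply : ∀ {n} → (Fin n → Fin n → Carrier) → Vector Carrier n → Vector Carrier n
  apply Q u j = ∑ λ k → Q j k * u k

  apply-cong : ∀ {n} (Q : Fin n → Fin n → Carrier) {u v} → (∀ k → u k ≈ v k) → ∀ j → apply Q u j ≈
      apply Q v j
  apply-cong Q u≈v j = ∑-cong λ k → *-congˡ (u≈v k)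

  apply-∑ : ∀ {n M} (Q : Fin n → Fin n → Carrier) (x : Vector Carrier M)
      (u : Fin M → Vector Carrier n) j →
            apply Q (λ k → ∑ λ t → x t * u t k) j ≈ ∑ λ t → x t * apply Q (u t) j
  apply-∑ {n} {M} Q x u j = begin-equality
    (∑ λ k → Q j k * ∑ λ t → x t * u t k)       ≈⟨ ∑-cong (λ k → *-distribˡ-∑ (Q j k) _) ⟩
    (∑ λ k → ∑ λ t → Q j k * (x t * u t k))     ≈⟨ ∑-swap _ ⟩
    (∑ λ t → ∑ λ k → Q j k * (x t * u t k))
      ≈⟨ ∑-cong (λ t → ∑-cong λ k → solve 3 (λ q x u → q :* (x :* u) := x :* (q :* u))
          refl (Q j k) (x t) (u t k)) ⟩
    (∑ λ t → ∑ λ k → x t * (Q j k * u t k))     ≈⟨ ∑-cong (λ t → *-distribˡ-∑ (x t) _) ⟨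
    (∑ λ t → x t * apply Q (u t) j)             ∎

  -- If f (t + 1) = Qᵗ (f 1), then the sum μ of t (f t) satisfies μ = β + Q μ,
  -- where β is the sum of f t, which satisfies β = f 1 + Q β.
  module FirstStep {n} (Q : Fin n → Fin n → Carrier) (0≤Q : ∀ j k → 0# ≤ Q j k)
                   (f : ℕ → Vector Carrier n)
                   (f-zero : ∀ j → f 0 j ≈ 0#)
                   (f-suc : ∀ t j → f (suc (suc t)) j ≈ apply Q (f (suc t)) j) where

    total moment : ℕ → Vector Carrier n
    total  M j = ∑ {M} λ t → f (toℕ t) j
    moment M j = ∑ {M} λ t → fromℕ (toℕ t) * f (toℕ t) j

    opaque
      unfolding ∑

      total-split : ∀ M j → total (suc (suc M)) j ≈ f 1 j + ∑ {M} λ t → f (suc (suc (toℕ t))) j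
      total-split M j = trans (+-congʳ (f-zero j)) (+-identityˡ _)

      total-suc-split : ∀ M j → total (suc M) j ≈ ∑ {M} λ t → 1# * f (suc (toℕ t)) j
      total-suc-split M j = trans (+-congʳ (f-zero j))
          (trans (+-identityˡ _) (∑-cong {M} λ t → sym (*-identityˡ _)))

      -- Splitting the time `t + 2` into `1 + (t + 1)` hands one copy of each later term to the
      -- total; the weight that remains is the one in the moment one step earlier.
      moment-split : ∀ M j → moment (suc (suc M)) j ≈
                     f 1 j + ∑ {M} λ t → f (suc (suc (toℕ t))) j
                         + fromℕ (suc (toℕ t)) * f (suc (suc (toℕ t))) j
      moment-split M j = trans
        (solve 3 (λ x y z → :0 :* x :+ ((:1 :+ :0) :* y :+ z) := y :+ z) refl (f 0 j) (f 1 j) _)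
        (+-congˡ (∑-cong {M} λ t → trans (distribʳ _ _ _) (+-congʳ (*-identityˡ _))))

      moment-suc-split : ∀ M j → moment (suc M) j ≈ ∑ {M} λ t → fromℕ (suc (toℕ t)) * f (suc (toℕ t)) j
      moment-suc-split M j = solve 2 (λ x u → :0 :* x :+ u := u) refl (f 0 j) _

    -- Arbitrary coefficients let one argument serve both the totals, with coefficients 1, and the
    -- moments, with the times.
    shift : ∀ M (x : Vector Carrier M) j →
            (∑ λ t → x t * f (suc (suc (toℕ t))) j) ≈ apply Q (λ k → ∑ λ t → x t * f (suc (toℕ t)) k) j
    shift M x j = begin-equality
      (∑ λ t → x t * f (suc (suc (toℕ t))) j)
        ≈⟨ ∑-cong (λ t → *-congˡ (f-suc (toℕ t) j)) ⟩
      (∑ λ t → x t * apply Q (f (suc (toℕ t))) j)         ≈⟨ apply-∑ Q x (f ∘ suc ∘ toℕ) j ⟨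
      apply Q (λ k → ∑ λ t → x t * f (suc (toℕ t)) k) j   ∎

    total-suc : ∀ M j → total (suc (suc M)) j ≈ f 1 j + apply Q (total (suc M)) j
    total-suc M j = begin-equality
      total (suc (suc M)) j                                       ≈⟨ total-split M j ⟩
      f 1 j + ∑ {M} (λ t → f (suc (suc (toℕ t))) j)
        ≈⟨ +-congˡ (∑-cong λ t → *-identityˡ _) ⟨
      f 1 j + ∑ {M} (λ t → 1# * f (suc (suc (toℕ t))) j)
        ≈⟨ +-congˡ (shift M (λ _ → 1#) j) ⟩
      f 1 j + apply Q (λ k → ∑ {M} λ t → 1# * f (suc (toℕ t)) k) j
        ≈⟨ +-congˡ (apply-cong Q (total-suc-split M) j) ⟨
      f 1 j + apply Q (total (suc M)) j ∎

    moment-suc : ∀ M j → moment (suc (suc M)) j ≈ total (suc (suc M)) j + apply Q (moment (suc M)) j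
    moment-suc M j = begin-equality
      moment (suc (suc M)) j                                      ≈⟨ moment-split M j ⟩
      f 1 j + (∑ {M} λ t → later t + fromℕ (suc (toℕ t)) * later t)
        ≈⟨ +-congˡ (∑-distrib-+ later _) ⟩
      f 1 j + (∑ later + ∑ λ t → fromℕ (suc (toℕ t)) * later t)     ≈⟨ +-assoc _ _ _ ⟨
      f 1 j + ∑ later + (∑ λ t → fromℕ (suc (toℕ t)) * later t)
        ≈⟨ +-cong (sym (total-split M j)) (shift M (λ t → fromℕ (suc (toℕ t))) j) ⟩
      total (suc (suc M)) j + apply Q (λ k → ∑ {M} λ t → fromℕ (suc (toℕ t)) * f (suc (toℕ t)) k) j
        ≈⟨ +-congˡ (apply-cong Q (moment-suc-split M) j) ⟨
      total (suc (suc M)) j + apply Q (moment (suc M)) j ∎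
      where
      later : Vector Carrier M
      later t = f (suc (suc (toℕ t))) j

    module _ {μ : Vector Carrier n} (μ-sum : ∀ j → HasSum (λ t → fromℕ t * f t j) (μ j)) where

      Lim-moment : ∀ j → Lim (λ M → moment M j) (μ j)
      Lim-moment j = Lim-cong (λ M → sym (∑≈sum {M} _)) refl (μ-sum j)

      -- Convergence of the totals is not among the hypotheses, and bounded monotone sequences need
      -- not converge in an ordered field. But `moment-suc` writes each total as a difference of
      -- expressions in the moments, which do converge, and this is the resulting limit.
      β : Vector Carrier n
      β j = μ j - apply Q μ j

      Lim-apply : ∀ {a : ℕ → Vector Carrier n} {s} → (∀ k → Lim (λ M → a M k) (s k)) →
                  ∀ j → Lim (λ M → apply Q (a M) j) (apply Q s j)
      Lim-apply a→s j = Lim-∑ _ _ λ k → Lim-* (Q j k) (0≤Q j k) (a→s k)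

      Lim-total : ∀ j → Lim (λ M → total (suc (suc M)) j) (β j)
      Lim-total j = Lim-cong
        (λ M → trans (+-congʳ (moment-suc M j)) (solve 2 (λ x y → x :+ y :- y := x) refl _ _))
        refl
        (Lim-+ (Lim-suc (Lim-suc (Lim-moment j)))
               (Lim-neg (Lim-apply {λ M → moment (suc M)} (λ k → Lim-suc (Lim-moment k)) j)))

      β-fixed : ∀ j → β j ≈ f 1 j + apply Q β j
      β-fixed j = Lim-unique (Lim-suc (Lim-total j))
        (Lim-cong (λ M → sym (total-suc (suc M) j)) refl
          (Lim-+ (Lim-const (f 1 j)) (Lim-apply Lim-total j)))

-- Indicator functions of vertex sets.

module Indicators {ℓ ℓ₁ ℓ₂} (R : OrderedField ℓ ℓ₁ ℓ₂) where

  open OrderedFieldProperties R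
  open OverField R
  open ≤-Reasoning

  -- Indicators with values in the field turn conditional sums into products, to which the sum laws
  -- and the ring solver apply.
  χ : ∀ {n} → Subset n → Vector Carrier n
  χ S i = if lookup S i then 1# else 0#

  χ-∈ : ∀ {n} {S : Subset n} {i} → i ∈ S → χ S i ≈ 1#
  χ-∈ i∈S rewrite []=⇒lookup i∈S = refl

  χ-∉ : ∀ {n} {S : Subset n} {i} → i ∉ S → χ S i ≈ 0#
  χ-∉ {S = S} {i} i∉S with lookup S i in eq
  ... | false = refl
  ... | true  = contradiction (lookup⇒[]= i S eq) i∉S

  χ-idem : ∀ {n} (S : Subset n) i → χ S i * χ S i ≈ χ S i
  χ-idem S i with lookup S i
  ... | true  = *-identityˡ 1#
  ... | false = zeroˡ 0#

  χ-nonNeg : ∀ {n} (S : Subset n) i → 0# ≤ χ S i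
  χ-nonNeg S i = ≤-trans (square-nonNeg _) (≤-reflexive (χ-idem S i))

  χ-∁ : ∀ {n} (S : Subset n) i → χ (∁ S) i ≈ 1# - χ S i
  χ-∁ S i with i ∈? S
  ... | yes i∈S = begin-equality
    χ (∁ S) i    ≈⟨ χ-∉ (x∈p⇒x∉∁p i∈S) ⟩
    0#           ≈⟨ -‿inverseʳ 1# ⟨
    1# - 1#      ≈⟨ +-congˡ (-‿cong (χ-∈ i∈S)) ⟨
    1# - χ S i   ∎
  ... | no i∉S = begin-equality
    χ (∁ S) i    ≈⟨ χ-∈ (x∉p⇒x∈∁p i∉S) ⟩
    1#           ≈⟨ solve 0 (:1 := :1 :- :0) refl ⟩
    1# - 0#      ≈⟨ +-congˡ (-‿cong (χ-∉ i∉S)) ⟨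
    1# - χ S i   ∎

  sumOver≈∑χ : ∀ {n} (S : Subset n) (f : Vector Carrier n) → sumOver S f ≈ ∑ λ i → χ S i * f i
  sumOver≈∑χ S f = trans (sym (∑≈sum _)) (∑-cong term)
    where
    term : ∀ i → (if lookup S i then f i else 0#) ≈ χ S i * f i
    term i with lookup S i
    ... | true  = sym (*-identityˡ (f i))
    ... | false = sym (zeroˡ (f i))

  χ⁅⁆-∑ : ∀ {n} (i : Fin n) (f : Vector Carrier n) → ∑ (λ x → χ ⁅ i ⁆ x * f x) ≈ f i
  χ⁅⁆-∑ i f = begin-equality
    ∑ (λ x → χ ⁅ i ⁆ x * f x)
      ≈⟨ ∑-supported _ i (λ x x≢i → trans (*-congʳ (χ-∉ (x≢i ∘ x∈⁅y⁆⇒x≡y i))) (zeroˡ _)) ⟩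
    χ ⁅ i ⁆ i * f i             ≈⟨ *-congʳ (χ-∈ (x∈⁅x⁆ i)) ⟩
    1# * f i                    ≈⟨ *-identityˡ (f i) ⟩
    f i                         ∎

  χ⁅⁆-sym : ∀ {n} (i x : Fin n) → χ ⁅ i ⁆ x ≈ χ ⁅ x ⁆ i
  χ⁅⁆-sym i x with x ∈? ⁅ i ⁆
  ... | yes x∈⁅i⁆ rewrite x∈⁅y⁆⇒x≡y i x∈⁅i⁆ = refl
  ... | no  x∉⁅i⁆ = trans (χ-∉ x∉⁅i⁆)
      (sym (χ-∉ λ i∈⁅x⁆ → x∉⁅i⁆ (≡.subst (_∈ ⁅ i ⁆) (x∈⁅y⁆⇒x≡y x i∈⁅x⁆) (x∈⁅x⁆ i))))

  χ⁅⁆-* : ∀ {n} (i : Fin n) (f : Vector Carrier n) x → χ ⁅ i ⁆ x * f x ≈ χ ⁅ i ⁆ x * f i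
  χ⁅⁆-* i f x with x ∈? ⁅ i ⁆
  ... | yes x∈⁅i⁆ rewrite x∈⁅y⁆⇒x≡y i x∈⁅i⁆ = refl
  ... | no  x∉⁅i⁆ = trans (trans (*-congʳ (χ-∉ x∉⁅i⁆)) (zeroˡ _))
      (sym (trans (*-congʳ (χ-∉ x∉⁅i⁆)) (zeroˡ _)))

  singletons : ∀ {n} → IsPartition {n} ⁅_⁆
  singletons = record
    { nonempty = λ i → i , x∈⁅x⁆ i
    ; disjoint = λ i j i≢j (x , x∈∩) → i≢j (disjoint i j x x∈∩)
    ; covering = λ i → i , x∈⁅x⁆ i
    }
    where
    disjoint : ∀ i j x → x ∈ ⁅ i ⁆ ∩ ⁅ j ⁆ → i ≡ j
    disjoint i j x x∈∩ with x∈p∩q⁻ ⁅ i ⁆ ⁅ j ⁆ x∈∩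
    ... | x∈i , x∈j = ≡.trans (≡.sym (x∈⁅y⁆⇒x≡y i x∈i)) (x∈⁅y⁆⇒x≡y j x∈j)

  ∑-χ-partition : ∀ {n m} {V : Fin m → Subset n} → IsPartition V → ∀ i → ∑ (λ a → χ (V a) i) ≈ 1#
  ∑-χ-partition {V = V} partition i = trans
    (∑-supported (λ a → χ (V a) i) b λ a a≢b → χ-∉ λ i∈Va → disjoint a b a≢b (i , x∈p∩q⁺ (i∈Va , i∈Vb)))
    (χ-∈ i∈Vb)
    where
    open IsPartition partition
    b = proj₁ (covering i)
    i∈Vb = proj₂ (covering i)

-- The Laplacian and the Dirichlet form of the weights.

module DirichletForm {ℓ ℓ₁ ℓ₂} (R : OrderedField ℓ ℓ₁ ℓ₂) {n} (G : OverField.WeightedGraph R n) where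

  open OrderedFieldProperties R
  open OverField R using (module WeightedGraph)
  open WeightedGraph G
  open Limits R using (half; 0<half; half*[x+x])
  open Indicators R
  open ≤-Reasoning

  -- The combinatorial Laplacian `D - A`, in a form from which it is plain that constants are
  -- harmonic.
  Δ : Vector Carrier n → Vector Carrier n
  Δ u x = ∑ λ y → weight x y * (u x - u y)

  E : Vector Carrier n → Vector Carrier n → Carrier
  E u v = ∑ λ x → u x * Δ v x

  -- Summation by parts: the second copy of the double sum is taken with `x` and `y` interchanged,
  -- and symmetry of the weights merges the two into a product of differences. Doubling keeps the
  -- factor one half out of the sums.
  E+E : ∀ u v → E u v + E u v ≈ ∑ λ x → ∑ λ y → weight x y * ((u x - u y) * (v x - v y))
  E+E u v = begin-equality
    E u v + E u v
      ≈⟨ +-cong E≈ (trans E≈ (∑-swap _)) ⟩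
    (∑ λ x → ∑ λ y → u x * (weight x y * (v x - v y)))
        + (∑ λ x → ∑ λ y → u y * (weight y x * (v y - v x)))
      ≈⟨ trans (∑-cong λ x → ∑-distrib-+ _ _) (∑-distrib-+ _ _) ⟨
    (∑ λ x → ∑ λ y → u x * (weight x y * (v x - v y)) + u y * (weight y x * (v y - v x)))
      ≈⟨ ∑-cong (λ x → ∑-cong λ y → +-congˡ (*-congˡ (*-congʳ (symmetric y x)))) ⟩
    (∑ λ x → ∑ λ y → u x * (weight x y * (v x - v y)) + u y * (weight x y * (v y - v x)))
      ≈⟨ ∑-cong (λ x → ∑-cong λ y → solve 5
          (λ w a b c d → a :* (w :* (c :- d)) :+ b :* (w :* (d :- c)) :=
              w :* ((a :- b) :* (c :- d))) refl (weight x y) (u x) (u y) (v x) (v y)) ⟩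
    (∑ λ x → ∑ λ y → weight x y * ((u x - u y) * (v x - v y))) ∎
    where
    E≈ : E u v ≈ ∑ λ x → ∑ λ y → u x * (weight x y * (v x - v y))
    E≈ = ∑-cong λ x → *-distribˡ-∑ (u x) _

  E-sym : ∀ u v → E u v ≈ E v u
  E-sym u v = begin-equality
    E u v                       ≈⟨ half*[x+x] (E u v) ⟨
    half * (E u v + E u v)      ≈⟨ *-congˡ (E+E u v) ⟩
    half * (∑ λ x → ∑ λ y → weight x y * ((u x - u y) * (v x - v y)))
      ≈⟨ *-congˡ (∑-cong λ x → ∑-cong λ y → *-congˡ (*-comm _ _)) ⟩
    half * (∑ λ x → ∑ λ y → weight x y * ((v x - v y) * (u x - u y)))
      ≈⟨ *-congˡ (E+E v u) ⟨
    half * (E v u + E v u)      ≈⟨ half*[x+x] (E v u) ⟩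
    E v u                       ∎

  edgeEnergy-nonNeg : ∀ (u : Vector Carrier n) x y → 0# ≤ weight x y * ((u x - u y) * (u x - u y))
  edgeEnergy-nonNeg u x y = *-nonNeg (nonNeg x y) (square-nonNeg _)

  E-nonNeg : ∀ u → 0# ≤ E u u
  E-nonNeg u = begin
    0#
      ≤⟨ *-nonNeg (proj₁ 0<half) (∑-nonNeg λ x → ∑-nonNeg (edgeEnergy-nonNeg u x)) ⟩
    half * (∑ λ x → ∑ λ y → weight x y * ((u x - u y) * (u x - u y)))  ≈⟨ *-congˡ (E+E u u) ⟨
    half * (E u u + E u u)     ≈⟨ half*[x+x] (E u u) ⟩
    E u u                      ∎

  -- Nonnegative edge terms with sum zero all vanish, so `u` does not change across an edge of
  -- positive weight, nor therefore along a path.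
  E≈0⇒constant : ∀ u → E u u ≈ 0# → ∀ x y → u x ≈ u y
  E≈0⇒constant u E≈0 x y = along (connected x y)
    where
    E+E≈0 : (∑ λ x → ∑ λ y → weight x y * ((u x - u y) * (u x - u y))) ≈ 0#
    E+E≈0 = trans (sym (E+E u u)) (trans (+-cong E≈0 E≈0) (+-identityˡ 0#))
    across : ∀ {x y} → Edge x y → u x ≈ u y
    across {x} {y} edge = diff≈0⇒≈ (x*x≈0⇒x≈0 (x*y≈0⇒y≈0 (pos⇒≉0 edge)
      (∑≈0⇒≈0 (edgeEnergy-nonNeg u x) (∑≈0⇒≈0 (λ x → ∑-nonNeg (edgeEnergy-nonNeg u x)) E+E≈0 x) y)))
    along : ∀ {x y} → Star Edge x y → u x ≈ u y
    along Star.ε        = refl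
    along (edge ◅ path) = trans (across edge) (along path)

  -- This takes the place of a maximum principle. It identifies the stationary distribution and
  -- shows that Kemeny's constant does not depend on the starting vertex.
  harmonic⇒constant : ∀ u → (∀ x → Δ u x ≈ 0#) → ∀ x y → u x ≈ u y
  harmonic⇒constant u Δu≈0 = E≈0⇒constant u (∑-zero λ x → trans (*-congˡ (Δu≈0 x)) (zeroʳ _))

  Δ-cong : ∀ {u v} → (∀ x → u x ≈ v x) → ∀ x → Δ u x ≈ Δ v x
  Δ-cong u≈v x = ∑-cong λ y → *-congˡ (+-cong (u≈v x) (-‿cong (u≈v y)))

  E-cong : ∀ {u v} → (∀ x → u x ≈ v x) → E u u ≈ E v v
  E-cong u≈v = ∑-cong λ x → *-cong (u≈v x) (Δ-cong u≈v x)

  Δ-∑ : ∀ {m} (p : Vector Carrier m) (f : Fin m → Vector Carrier n) x →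
        Δ (λ x → ∑ λ i → p i * f i x) x ≈ ∑ λ i → p i * Δ (f i) x
  Δ-∑ p f x = begin-equality
    (∑ λ y → weight x y * ((∑ λ i → p i * f i x) - (∑ λ i → p i * f i y)))
      ≈⟨ ∑-cong (λ y → trans (*-congˡ (sym (∑-distrib-- _ _))) (*-distribˡ-∑ _ _)) ⟩
    (∑ λ y → ∑ λ i → weight x y * (p i * f i x - p i * f i y))
      ≈⟨ ∑-swap _ ⟩
    (∑ λ i → ∑ λ y → weight x y * (p i * f i x - p i * f i y))
      ≈⟨ ∑-cong (λ i → ∑-cong λ y → solve 4
          (λ w p a b → w :* (p :* a :- p :* b) := p :* (w :* (a :- b)))
              refl (weight x y) (p i) (f i x) (f i y)) ⟩
    (∑ λ i → ∑ λ y → p i * (weight x y * (f i x - f i y)))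
      ≈⟨ ∑-cong (λ i → *-distribˡ-∑ (p i) _) ⟨
    (∑ λ i → p i * Δ (f i) x) ∎

  E-∑ˡ : ∀ {m} (p : Vector Carrier m) (f : Fin m → Vector Carrier n) v →
         E (λ x → ∑ λ i → p i * f i x) v ≈ ∑ λ i → p i * E (f i) v
  E-∑ˡ p f v = begin-equality
    (∑ λ x → (∑ λ i → p i * f i x) * Δ v x)     ≈⟨ ∑-cong (λ x → *-distribʳ-∑ _ _) ⟩
    (∑ λ x → ∑ λ i → p i * f i x * Δ v x)       ≈⟨ ∑-swap _ ⟩
    (∑ λ i → ∑ λ x → p i * f i x * Δ v x)
      ≈⟨ ∑-cong (λ i → trans (∑-cong λ x → *-assoc _ _ _) (sym (*-distribˡ-∑ _ _))) ⟩
    (∑ λ i → p i * E (f i) v) ∎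

  E-linearʳ : ∀ w s u v → E w (λ x → s * u x - v x) ≈ s * E w u - E w v
  E-linearʳ w s u v = begin-equality
    (∑ λ x → w x * ∑ λ y → weight x y * (s * u x - v x - (s * u y - v y)))
      ≈⟨ ∑-cong (λ x → *-congˡ (Δ-linear x)) ⟩
    (∑ λ x → w x * (s * Δ u x - Δ v x))
      ≈⟨ ∑-cong (λ x → solve 4 (λ w s a b → w :* (s :* a :- b) := s :* (w :* a) :- w :* b)
          refl (w x) s (Δ u x) (Δ v x)) ⟩
    (∑ λ x → s * (w x * Δ u x) - w x * Δ v x)
      ≈⟨ trans (∑-distrib-- _ _) (+-congʳ (sym (*-distribˡ-∑ s _))) ⟩
    s * E w u - E w v ∎
    where
    Δ-linear : ∀ x → (∑ λ y → weight x y * (s * u x - v x - (s * u y - v y))) ≈ s * Δ u x - Δ v x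
    Δ-linear x = begin-equality
      (∑ λ y → weight x y * (s * u x - v x - (s * u y - v y)))
        ≈⟨ ∑-cong (λ y → solve 6 (λ w s a b c d → w :* (s :* a :- b :- (s :* c :- d)) :=
            s :* (w :* (a :- c)) :- w :* (b :- d)) refl (weight x y) s (u x) (v x) (u y) (v y)) ⟩
      (∑ λ y → s * (weight x y * (u x - u y)) - weight x y * (v x - v y))
        ≈⟨ trans (∑-distrib-- _ _) (+-congʳ (sym (*-distribˡ-∑ s _))) ⟩
      s * Δ u x - Δ v x ∎

  E-square : ∀ s u v → E (λ x → s * u x - v x) (λ x → s * u x - v x) ≈
             s * s * E u u - (1# + 1#) * s * E u v + E v v
  E-square s u v = begin-equality
    E w w                                                         ≈⟨ E-linearʳ w s u v ⟩
    s * E w u - E w v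
      ≈⟨ +-cong (*-congˡ (E-sym w u)) (-‿cong (E-sym w v)) ⟩
    s * E u w - E v w
      ≈⟨ +-cong (*-congˡ (E-linearʳ u s u v)) (-‿cong (E-linearʳ v s u v)) ⟩
    s * (s * E u u - E u v) - (s * E v u - E v v)
      ≈⟨ +-congˡ (-‿cong (+-congʳ (*-congˡ (E-sym v u)))) ⟩
    s * (s * E u u - E u v) - (s * E u v - E v v)
      ≈⟨ solve 4 (λ s a b d → s :* (s :* a :- b) :- (s :* b :- d) := s :* s :* a
          :- (:1 :+ :1) :* s :* b :+ d) refl s (E u u) (E u v) (E v v) ⟩
    s * s * E u u - (1# + 1#) * s * E u v + E v v                 ∎
    where
    w = λ x → s * u x - v x

  -- Expand ∑ (pᵢ / kᵢ) E (c kᵢ F - fᵢ) ≥ 0 with c = (∑ pᵢ kᵢ)⁻¹.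
  E-convex : ∀ {m} (p k : Vector Carrier m) (f : Fin m → Vector Carrier n) →
             (∀ i → 0# ≤ p i) → (∀ i → 0# < k i) → 0# < ∑ (λ i → p i * k i) →
             let F = λ x → ∑ λ i → p i * f i x in
             E F F / ∑ (λ i → p i * k i) ≤ ∑ λ i → p i * (E (f i) (f i) / k i)
  E-convex p k f 0≤p 0<k 0<K = 0≤⇒≤
      (∑-nonNeg λ i → *-nonNeg (*-nonNeg (0≤p i) (proj₁ (⁻¹-pos (0<k i))))
          (E-nonNeg (w i))) $ sym $ begin-equality
    E F F * c + (∑ λ i → p i * k i ⁻¹ * E (w i) (w i))
      ≈⟨ +-congˡ (∑-cong expand) ⟩
    E F F * c + (∑ λ i → c * c * E F F * (p i * k i) - (1# + 1#) * c * (p i * E (f i) F)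
        + p i * (E (f i) (f i) / k i))
      ≈⟨ +-congˡ (trans (∑-distrib-+ _ _) (+-congʳ (∑-distrib-- _ _))) ⟩
    E F F * c + ((∑ λ i → c * c * E F F * (p i * k i)) - (∑ λ i → (1# + 1#) * c * (p i * E (f i) F)) + T)
      ≈⟨ +-congˡ (+-congʳ (+-cong (sym (*-distribˡ-∑ _ _))
          (-‿cong (trans (sym (*-distribˡ-∑ _ _)) (*-congˡ (sym (E-∑ˡ p f F))))))) ⟩
    E F F * c + (c * c * E F F * K - (1# + 1#) * c * E F F + T)
      ≈⟨ solve 4 (λ e c K T → e :* c :+ (c :* c :* e :* K :- (:1 :+ :1) :* c :* e :+ T) :=
          e :* c :* (K :* c) :- e :* c :+ T) refl (E F F) c K T ⟩
    E F F * c * (K * c) - E F F * c + T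
      ≈⟨ +-congʳ (+-congʳ (trans (*-congˡ (⁻¹-inverseʳ (pos⇒≉0 0<K))) (*-identityʳ _))) ⟩
    E F F * c - E F F * c + T
      ≈⟨ trans (+-congʳ (-‿inverseʳ _)) (+-identityˡ T) ⟩
    T ∎
    where
    F : Vector Carrier n
    F x = ∑ λ i → p i * f i x
    K = ∑ λ i → p i * k i
    c = K ⁻¹
    T = ∑ λ i → p i * (E (f i) (f i) / k i)
    w : _ → Vector Carrier n
    w i x = c * k i * F x - f i x
    expand : ∀ i → p i * k i ⁻¹ * E (w i) (w i) ≈
             c * c * E F F * (p i * k i) - (1# + 1#) * c * (p i * E (f i) F)
                 + p i * (E (f i) (f i) / k i)
    expand i = begin-equality
      p i * k i ⁻¹ * E (w i) (w i)
        ≈⟨ *-congˡ (E-square (c * k i) F (f i)) ⟩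
      p i * k i ⁻¹ * (c * k i * (c * k i) * E F F - (1# + 1#) * (c * k i) * E F (f i) + E (f i) (f i))
        ≈⟨ solve 7 (λ p k k⁻¹ c e e′ e″ → p :* k⁻¹ :* (c :* k :* (c :* k) :* e
            :- (:1 :+ :1) :* (c :* k) :* e′ :+ e″) := c :* c :* e :* (p :* k) :* (k :* k⁻¹)
                :- (:1 :+ :1) :* c :* (p :* e′) :* (k :* k⁻¹) :+ p :* (e″ :* k⁻¹))
                    refl (p i) (k i) (k i ⁻¹) c (E F F) (E F (f i)) (E (f i) (f i)) ⟩
      c * c * E F F * (p i * k i) * (k i * k i ⁻¹)
          - (1# + 1#) * c * (p i * E F (f i)) * (k i * k i ⁻¹) + p i * (E (f i) (f i) / k i)
        ≈⟨ +-congʳ (+-cong (cancel _) (-‿cong (trans (cancel _) (*-congˡ (*-congˡ (E-sym F (f i))))))) ⟩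
      c * c * E F F * (p i * k i) - (1# + 1#) * c * (p i * E (f i) F) + p i * (E (f i) (f i) / k i) ∎
      where
      cancel : ∀ x → x * (k i * k i ⁻¹) ≈ x
      cancel x = trans (*-congˡ (⁻¹-inverseʳ (pos⇒≉0 (0<k i)))) (*-identityʳ x)

-- Degrees and volumes.

module Degrees {ℓ ℓ₁ ℓ₂} (R : OrderedField ℓ ℓ₁ ℓ₂) {n} (G : OverField.WeightedGraph R n) where

  open OrderedFieldProperties R
  open OverField R using (module WeightedGraph; degree; vol)
  open WeightedGraph G
  open Indicators R
  open ≤-Reasoning

  deg : Vector Carrier n
  deg = degree G

  deg≈∑ : ∀ i → deg i ≈ ∑ (weight i)
  deg≈∑ i = sym (∑≈sum (weight i))

  another : ∀ {n} → 2 ≤ℕ n → (i : Fin n) → ∃ λ j → i ≢ j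
  another (s≤s (s≤s z≤n)) zero    = suc zero , λ ()
  another (s≤s (s≤s z≤n)) (suc i) = zero , λ ()

  -- A path from `i` to a second vertex must begin with an edge of positive weight at `i`.
  deg-pos : 2 ≤ℕ n → ∀ i → 0# < deg i
  deg-pos 2≤n i = leave (another 2≤n i)
    where
    leave : (∃ λ j → i ≢ j) → 0# < deg i
    leave (j , i≢j) with connected i j
    ... | Star.ε = contradiction ≡.refl i≢j
    ... | _◅_ {j = k} edge _ = begin-strict
      0#               <⟨ edge ⟩
      weight i k       ≤⟨ term≤∑ (nonNeg i) k ⟩
      ∑ (weight i)     ≈⟨ deg≈∑ i ⟨
      deg i            ∎

  vol≈∑ : ∀ S → vol G S ≈ ∑ λ i → χ S i * deg i
  vol≈∑ S = sumOver≈∑χ S deg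

  vol-pos : (∀ i → 0# < deg i) → ∀ {S} → Nonempty S → 0# < vol G S
  vol-pos 0<deg {S} (i , i∈S) = begin-strict
    0#                           <⟨ 0<deg i ⟩
    deg i                        ≈⟨ *-identityˡ _ ⟨
    1# * deg i                   ≈⟨ *-congʳ (χ-∈ i∈S) ⟨
    χ S i * deg i                ≤⟨ term≤∑ (λ j → *-nonNeg (χ-nonNeg S j) (proj₁ (0<deg j))) i ⟩
    ∑ (λ i → χ S i * deg i)      ≈⟨ vol≈∑ S ⟨
    vol G S                      ∎

  vol-⁅⁆ : ∀ i → vol G ⁅ i ⁆ ≈ deg i
  vol-⁅⁆ i = trans (vol≈∑ ⁅ i ⁆) (χ⁅⁆-∑ i deg)

  ∑-vol : ∀ {m} {V : Fin m → Subset n} → OverField.IsPartition R V → ∑ (λ a → vol G (V a)) ≈ ∑ deg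
  ∑-vol {V = V} partition = begin-equality
    ∑ (λ a → vol G (V a))                 ≈⟨ ∑-cong (λ a → vol≈∑ (V a)) ⟩
    ∑ (λ a → ∑ λ i → χ (V a) i * deg i)   ≈⟨ ∑-swap _ ⟩
    ∑ (λ i → ∑ λ a → χ (V a) i * deg i)
      ≈⟨ ∑-cong (λ i → trans (sym (*-distribʳ-∑ _ _))
          (trans (*-congʳ (∑-χ-partition partition i)) (*-identityˡ _))) ⟩
    ∑ deg                                 ∎

-- Energies of partitions and the bound on the Green energy.

module PartitionEnergy {ℓ ℓ₁ ℓ₂} (R : OrderedField ℓ ℓ₁ ℓ₂) {n} (G : OverField.WeightedGraph R n) where

  open OrderedFieldProperties R
  open DirichletForm R G
  open Indicators R
  open Degrees R G
  open OverField R using (module WeightedGraph; IsPartition; module IsPartition; vol; cut; NCut)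
  open WeightedGraph G
  open ≤-Reasoning

  -- Since `χ S` is idempotent, `χ S x * (1# - χ S y)` equals `χ S x * (χ S x - χ S y)`: each edge
  -- leaving `S` is counted once, from its end in `S`.
  cut≈E : ∀ S → cut G S (∁ S) ≈ E (χ S) (χ S)
  cut≈E S = begin-equality
    cut G S (∁ S)                                                   ≈⟨ sumOver≈∑χ S _ ⟩
    (∑ λ x → χ S x * OverField.sumOver R (∁ S) (weight x))
      ≈⟨ ∑-cong (λ x → trans (*-congˡ (sumOver≈∑χ (∁ S) (weight x))) (*-distribˡ-∑ _ _)) ⟩
    (∑ λ x → ∑ λ y → χ S x * (χ (∁ S) y * weight x y))
      ≈⟨ ∑-cong (λ x → ∑-cong (term x)) ⟩
    (∑ λ x → ∑ λ y → χ S x * (weight x y * (χ S x - χ S y)))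
      ≈⟨ ∑-cong (λ x → *-distribˡ-∑ _ _) ⟨
    E (χ S) (χ S) ∎
    where
    term : ∀ x y → χ S x * (χ (∁ S) y * weight x y) ≈ χ S x * (weight x y * (χ S x - χ S y))
    term x y = begin-equality
      χ S x * (χ (∁ S) y * weight x y)                 ≈⟨ *-congˡ (*-congʳ (χ-∁ S y)) ⟩
      χ S x * ((1# - χ S y) * weight x y)
        ≈⟨ solve 3 (λ a b w → a :* ((:1 :- b) :* w) := w :* a :- w :* (a :* b))
            refl (χ S x) (χ S y) (weight x y) ⟩
      weight x y * χ S x - weight x y * (χ S x * χ S y)   ≈⟨ +-congʳ (*-congˡ (χ-idem S x)) ⟨
      weight x y * (χ S x * χ S x) - weight x y * (χ S x * χ S y)
        ≈⟨ solve 3 (λ a b w → w :* (a :* a) :- w :* (a :* b) := a :* (w :* (a :- b)))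
            refl (χ S x) (χ S y) (weight x y) ⟩
      χ S x * (weight x y * (χ S x - χ S y))           ∎

  -- Here `ρ` is the reciprocal of the total degree, so `ρ * deg x` is the stationary probability of
  -- `x`. The equation fixes each `γ i` only up to an additive constant, which `E` does not see.
  module Potential
    (0<deg : ∀ i → 0# < deg i)
    (ρ : Carrier) (ρ-total : ρ * ∑ deg ≈ 1#)
    (γ : Fin n → Vector Carrier n)
    (Δγ : ∀ i x → Δ (γ i) x ≈ deg i * (χ ⁅ i ⁆ x - ρ * deg x)) where

    Γ : Subset n → Vector Carrier n
    Γ S x = ∑ λ i → χ S i * γ i x

    ΔΓ : ∀ S x → Δ (Γ S) x ≈ χ S x * deg x - vol G S * (ρ * deg x)
    ΔΓ S x = begin-equality
      Δ (Γ S) x                                                       ≈⟨ Δ-∑ (χ S) γ x ⟩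
      (∑ λ i → χ S i * Δ (γ i) x)                                     ≈⟨ ∑-cong term ⟩
      (∑ λ i → χ ⁅ x ⁆ i * (χ S i * deg i) - χ S i * deg i * (ρ * deg x))   ≈⟨ ∑-distrib-- _ _ ⟩
      (∑ λ i → χ ⁅ x ⁆ i * (χ S i * deg i)) - (∑ λ i → χ S i * deg i * (ρ * deg x))
        ≈⟨ +-cong (χ⁅⁆-∑ x _) (-‿cong (trans (sym (*-distribʳ-∑ _ _)) (*-congʳ (sym (vol≈∑ S))))) ⟩
      χ S x * deg x - vol G S * (ρ * deg x) ∎
      where
      term : ∀ i → χ S i * Δ (γ i) x ≈ χ ⁅ x ⁆ i * (χ S i * deg i) - χ S i * deg i * (ρ * deg x)
      term i = begin-equality
        χ S i * Δ (γ i) x                                ≈⟨ *-congˡ (Δγ i x) ⟩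
        χ S i * (deg i * (χ ⁅ i ⁆ x - ρ * deg x))
          ≈⟨ *-congˡ (*-congˡ (+-congʳ (χ⁅⁆-sym i x))) ⟩
        χ S i * (deg i * (χ ⁅ x ⁆ i - ρ * deg x))
          ≈⟨ solve 4 (λ s d e r → s :* (d :* (e :- r)) := e :* (s :* d) :- s :* d :* r)
              refl (χ S i) (deg i) (χ ⁅ x ⁆ i) (ρ * deg x) ⟩
        χ ⁅ x ⁆ i * (χ S i * deg i) - χ S i * deg i * (ρ * deg x)   ∎

    -- Divided by the volume and summed over a partition into `m` parts this gives `m - 1`; the lost
    -- unit is the dimension of the constants.
    E-χ-Γ : ∀ S → E (χ S) (Γ S) ≈ vol G S * (1# - ρ * vol G S)
    E-χ-Γ S = begin-equality
      (∑ λ x → χ S x * Δ (Γ S) x)                                          ≈⟨ ∑-cong term ⟩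
      (∑ λ x → χ S x * deg x * (1# - ρ * vol G S))                         ≈⟨ *-distribʳ-∑ _ _ ⟨
      (∑ λ x → χ S x * deg x) * (1# - ρ * vol G S)                         ≈⟨ *-congʳ (vol≈∑ S) ⟨
      vol G S * (1# - ρ * vol G S)                                         ∎
      where
      term : ∀ x → χ S x * Δ (Γ S) x ≈ χ S x * deg x * (1# - ρ * vol G S)
      term x = begin-equality
        χ S x * Δ (Γ S) x                                          ≈⟨ *-congˡ (ΔΓ S x) ⟩
        χ S x * (χ S x * deg x - vol G S * (ρ * deg x))
          ≈⟨ solve 4 (λ s d v r → s :* (s :* d :- v :* (r :* d)) := (s :* s) :* d
              :- s :* d :* (r :* v)) refl (χ S x) (deg x) (vol G S) ρ ⟩
        χ S x * χ S x * deg x - χ S x * deg x * (ρ * vol G S)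
          ≈⟨ +-congʳ (*-congʳ (χ-idem S x)) ⟩
        χ S x * deg x - χ S x * deg x * (ρ * vol G S)
          ≈⟨ solve 2 (λ a b → a :- a :* b := a :* (:1 :- b)) refl (χ S x * deg x) (ρ * vol G S) ⟩
        χ S x * deg x * (1# - ρ * vol G S) ∎

    residual : Carrier → Subset n → Vector Carrier n
    residual s S x = s * χ S x - Γ S x

    energy : ∀ {m} → Carrier → (Fin m → Subset n) → Carrier
    energy s V = ∑ λ a → E (residual s (V a)) (residual s (V a)) / vol G (V a)

    greenEnergy : ∀ {m} → (Fin m → Subset n) → Carrier
    greenEnergy V = ∑ λ a → E (Γ (V a)) (Γ (V a)) / vol G (V a)

    energy-nonNeg : ∀ {m} s {V : Fin m → Subset n} → IsPartition V → 0# ≤ energy s V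
    energy-nonNeg s partition = ∑-nonNeg λ a →
      *-nonNeg (E-nonNeg _) (proj₁ (⁻¹-pos (vol-pos 0<deg (IsPartition.nonempty partition a))))

    energy≈ : ∀ {m} s {V : Fin m → Subset n} → IsPartition V →
              energy s V ≈ s * s * NCut G V - (1# + 1#) * s * (fromℕ m - 1#) + greenEnergy V
    energy≈ {m} s {V} partition = begin-equality
      energy s V
        ≈⟨ ∑-cong term ⟩
      (∑ λ a → s * s * (cut G (V a) (∁ (V a)) / vol G (V a))
          - (1# + 1#) * s * (1# - ρ * vol G (V a)) + E (Γ (V a)) (Γ (V a)) / vol G (V a))
        ≈⟨ trans (∑-distrib-+ _ _) (+-congʳ (∑-distrib-- _ _)) ⟩
      (∑ λ a → s * s * (cut G (V a) (∁ (V a)) / vol G (V a)))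
          - (∑ λ a → (1# + 1#) * s * (1# - ρ * vol G (V a))) + greenEnergy V
        ≈⟨ +-congʳ (+-cong (trans (sym (*-distribˡ-∑ _ _)) (*-congˡ (∑≈sum _)))
            (-‿cong (trans (sym (*-distribˡ-∑ _ _)) (*-congˡ dimension)))) ⟩
      s * s * NCut G V - (1# + 1#) * s * (fromℕ m - 1#) + greenEnergy V ∎
      where
      dimension : (∑ λ a → 1# - ρ * vol G (V a)) ≈ fromℕ m - 1#
      dimension = begin-equality
        (∑ λ a → 1# - ρ * vol G (V a))                ≈⟨ ∑-distrib-- _ _ ⟩
        (∑ λ (a : Fin m) → 1#) - (∑ λ a → ρ * vol G (V a))
          ≈⟨ +-cong (∑-1 m) (-‿cong (sym (*-distribˡ-∑ ρ _))) ⟩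
        fromℕ m - ρ * (∑ λ a → vol G (V a))
          ≈⟨ +-congˡ (-‿cong (trans (*-congˡ (∑-vol partition)) ρ-total)) ⟩
        fromℕ m - 1# ∎
      term : ∀ a → E (residual s (V a)) (residual s (V a)) / vol G (V a) ≈
             s * s * (cut G (V a) (∁ (V a)) / vol G (V a)) - (1# + 1#) * s * (1# - ρ * vol G (V a))
                 + E (Γ (V a)) (Γ (V a)) / vol G (V a)
      term a = begin-equality
        E (residual s S) (residual s S) / v
          ≈⟨ *-congʳ (E-square s (χ S) (Γ S)) ⟩
        (s * s * E (χ S) (χ S) - (1# + 1#) * s * E (χ S) (Γ S) + E (Γ S) (Γ S)) / v
          ≈⟨ *-congʳ (+-congʳ (+-cong (*-congˡ (sym (cut≈E S))) (-‿cong (*-congˡ (E-χ-Γ S))))) ⟩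
        (s * s * cut G S (∁ S) - (1# + 1#) * s * (v * (1# - ρ * v)) + E (Γ S) (Γ S)) / v
          ≈⟨ solve 6 (λ s κ v q e i → (s :* s :* κ :- (:1 :+ :1) :* s :* (v :* q) :+ e) :* i :=
              s :* s :* (κ :* i) :- (:1 :+ :1) :* s :* (q :* (v :* i)) :+ e :* i)
                  refl s (cut G S (∁ S)) v (1# - ρ * v) (E (Γ S) (Γ S)) (v ⁻¹) ⟩
        s * s * (cut G S (∁ S) / v) - (1# + 1#) * s * ((1# - ρ * v) * (v * v ⁻¹)) + E (Γ S) (Γ S) / v
          ≈⟨ +-congʳ (+-congˡ (-‿cong
              (*-congˡ (trans (*-congˡ (⁻¹-inverseʳ (pos⇒≉0 0<v))) (*-identityʳ _))))) ⟩
        s * s * (cut G S (∁ S) / v) - (1# + 1#) * s * (1# - ρ * v) + E (Γ S) (Γ S) / v ∎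
        where
        S = V a
        v = vol G S
        0<v : 0# < v
        0<v = vol-pos 0<deg (IsPartition.nonempty partition a)

    Γ-⁅⁆ : ∀ i x → Γ ⁅ i ⁆ x ≈ γ i x
    Γ-⁅⁆ i x = χ⁅⁆-∑ i (λ i → γ i x)

    -- Both the residuals and the degrees add up over the vertices of a part, so `E-convex`, with
    -- the indicator of the part as weights, bounds its term by those of its singletons. Every
    -- vertex is then counted in exactly one part.
    energy-refine : ∀ {m} s {V : Fin m → Subset n} → IsPartition V → energy s V ≤ energy s ⁅_⁆
    energy-refine s {V} partition = begin
      energy s V                                              ≤⟨ ∑-mono-≤ part ⟩
      (∑ λ a → ∑ λ i → χ (V a) i * (E (f i) (f i) / deg i))   ≈⟨ ∑-swap _ ⟩
      (∑ λ i → ∑ λ a → χ (V a) i * (E (f i) (f i) / deg i))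
        ≈⟨ ∑-cong (λ i → trans (sym (*-distribʳ-∑ _ _))
            (trans (*-congʳ (∑-χ-partition partition i)) (*-identityˡ _))) ⟩
      (∑ λ i → E (f i) (f i) / deg i)
        ≈⟨ ∑-cong (λ i → *-cong (E-cong λ x → +-congˡ (-‿cong (sym (Γ-⁅⁆ i x))))
            (⁻¹-cong (sym (vol-⁅⁆ i)))) ⟩
      energy s ⁅_⁆                                            ∎
      where
      f : Fin n → Vector Carrier n
      f i x = s * χ ⁅ i ⁆ x - γ i x
      residual≈ : ∀ S x → residual s S x ≈ ∑ λ i → χ S i * f i x
      residual≈ S x = sym $ begin-equality
        (∑ λ i → χ S i * f i x)
          ≈⟨ ∑-cong (λ i → trans (*-congˡ (+-congʳ (*-congˡ (χ⁅⁆-sym i x))))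
              (solve 4 (λ a s d g → a :* (s :* d :- g) := s :* (d :* a) :- a :* g)
                  refl (χ S i) s (χ ⁅ x ⁆ i) (γ i x))) ⟩
        (∑ λ i → s * (χ ⁅ x ⁆ i * χ S i) - χ S i * γ i x)
          ≈⟨ trans (∑-distrib-- _ _) (+-congʳ (sym (*-distribˡ-∑ s _))) ⟩
        s * (∑ λ i → χ ⁅ x ⁆ i * χ S i) - Γ S x              ≈⟨ +-congʳ (*-congˡ (χ⁅⁆-∑ x (χ S))) ⟩
        residual s S x                                       ∎
      part : ∀ a → E (residual s (V a)) (residual s (V a)) / vol G (V a) ≤
          ∑ λ i → χ (V a) i * (E (f i) (f i) / deg i)
      part a = begin
        E (residual s (V a)) (residual s (V a)) / vol G (V a)
          ≈⟨ *-cong (E-cong (residual≈ (V a))) (⁻¹-cong (vol≈∑ (V a))) ⟩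
        E (λ x → ∑ λ i → χ (V a) i * f i x)
            (λ x → ∑ λ i → χ (V a) i * f i x) / ∑ (λ i → χ (V a) i * deg i)
          ≤⟨ E-convex (χ (V a)) deg f (χ-nonNeg (V a)) 0<deg 0<vol ⟩
        (∑ λ i → χ (V a) i * (E (f i) (f i) / deg i)) ∎
        where
        0<vol : 0# < ∑ (λ i → χ (V a) i * deg i)
        0<vol = begin-strict
          0#           <⟨ vol-pos 0<deg (IsPartition.nonempty partition a) ⟩
          vol G (V a)  ≈⟨ vol≈∑ (V a) ⟩
          ∑ (λ i → χ (V a) i * deg i) ∎

    -- Without loops all of the degree of a vertex is cut off, so each quotient is 1.
    NCut-singletons : NCut G ⁅_⁆ ≈ fromℕ n
    NCut-singletons = trans (sym (∑≈sum _)) (trans (∑-cong term) (∑-1 n))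
      where
      E-χ⁅⁆ : ∀ i → E (χ ⁅ i ⁆) (χ ⁅ i ⁆) ≈ deg i
      E-χ⁅⁆ i = begin-equality
        (∑ λ x → χ ⁅ i ⁆ x * Δ (χ ⁅ i ⁆) x)                          ≈⟨ χ⁅⁆-∑ i _ ⟩
        (∑ λ y → weight i y * (χ ⁅ i ⁆ i - χ ⁅ i ⁆ y))
          ≈⟨ ∑-cong (λ y → trans (*-congˡ (+-congʳ (χ-∈ (x∈⁅x⁆ i))))
              (solve 2 (λ w d → w :* (:1 :- d) := w :- d :* w) refl (weight i y) (χ ⁅ i ⁆ y))) ⟩
        (∑ λ y → weight i y - χ ⁅ i ⁆ y * weight i y)                ≈⟨ ∑-distrib-- _ _ ⟩
        ∑ (weight i) - (∑ λ y → χ ⁅ i ⁆ y * weight i y)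
          ≈⟨ +-cong (sym (deg≈∑ i)) (-‿cong (trans (χ⁅⁆-∑ i _) (loopless i))) ⟩
        deg i - 0#
          ≈⟨ solve 1 (λ d → d :- :0 := d) refl (deg i) ⟩
        deg i ∎
      term : ∀ i → cut G ⁅ i ⁆ (∁ ⁅ i ⁆) / vol G ⁅ i ⁆ ≈ 1#
      term i = trans (*-cong (trans (cut≈E ⁅ i ⁆) (E-χ⁅⁆ i)) (⁻¹-cong (vol-⁅⁆ i)))
          (⁻¹-inverseʳ (pos⇒≉0 (0<deg i)))

    greenEnergy-bound : ∀ {m} {V : Fin m → Subset n} → IsPartition V →
      0# < fromℕ m - 1# → 0# < fromℕ n - fromℕ m →
      (fromℕ m - 1#) * (fromℕ m - 1#) / NCut G V
          + (fromℕ n - fromℕ m) * (fromℕ n - fromℕ m) / (fromℕ n - NCut G V)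
        ≤ greenEnergy ⁅_⁆
    -- The parameters are eliminated one at a time: for fixed `t` the optimum over `s` is
    -- `p * p / x`, which does not involve `t` and is moved to the other side before optimizing over
    -- `t`. A denominator that fails to be positive is refuted inside `parabola-bound`.
    greenEnergy-bound {m} {V} partition 0<p 0<q = cancel (parabola-bound 0<q λ t →
        uncancel (parabola-bound 0<p λ s → quadratic s t))
      where
      x = NCut G V
      p = fromℕ m - 1#
      q = fromℕ n - fromℕ m
      K = greenEnergy ⁅_⁆
      T = greenEnergy V
      cancel : ∀ {a b} → b ≤ K - a → a + b ≤ K
      cancel {a} {b} b≤K-a = 0≤⇒≤ (≤⇒0≤ b≤K-a)
          (solve 3 (λ a b K → K := a :+ b :+ (K :- a :- b)) refl a b K)
      uncancel : ∀ {a b} → a ≤ K - b → b ≤ K - a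
      uncancel {a} {b} a≤K-b = 0≤⇒≤ (≤⇒0≤ a≤K-b)
          (solve 3 (λ a b K → K :- a := b :+ (K :- b :- a)) refl a b K)
      quadratic : ∀ s t → (1# + 1#) * s * p - s * s * x ≤ K - ((1# + 1#) * t * q - t * t * (fromℕ n - x))
      quadratic s t = 0≤⇒≤ (+-nonNeg
        (≤-trans (energy-nonNeg s partition) (≤-reflexive (energy≈ s partition)))
        (≤-trans (≤⇒0≤ (energy-refine t partition))
            (≤-reflexive (+-cong (energy≈ t singletons) (-‿cong (energy≈ t partition))))))
        (begin-equality
          K - ((1# + 1#) * t * q - t * t * (fromℕ n - x))
            ≈⟨ solve 8 (λ s t x m n p K T → K :- ((:1 :+ :1) :* t :* (n :- m) :- t :* t :* (n :- x))
                := (:1 :+ :1) :* s :* p :- s :* s :* x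
                    :+ ((s :* s :* x :- (:1 :+ :1) :* s :* p :+ T)
                        :+ ((t :* t :* n :- (:1 :+ :1) :* t :* (n :- :1) :+ K)
                            :- (t :* t :* x :- (:1 :+ :1) :* t :* (m :- :1) :+ T))))
                                refl s t x (fromℕ m) (fromℕ n) p K T ⟩
          _ ≈⟨ +-congˡ (+-congˡ (+-congʳ (+-congʳ (+-congʳ (*-congˡ NCut-singletons))))) ⟨
          (1# + 1#) * s * p - s * s * x
            + ((s * s * x - (1# + 1#) * s * p + T)
            + ((t * t * NCut G ⁅_⁆ - (1# + 1#) * t * (fromℕ n - 1#) + K)
            - (t * t * x - (1# + 1#) * t * (fromℕ m - 1#) + T))) ∎)

-- Passage times, the stationary distribution and Kemeny's constant.

module RandomWalk {ℓ ℓ₁ ℓ₂} (R : OrderedField ℓ ℓ₁ ℓ₂) {n} (G : OverField.WeightedGraph R n) where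

  open OrderedFieldProperties R
  open DirichletForm R G
  open Indicators R
  open Degrees R G
  open OverField R using (module WeightedGraph; IsStationary; module IsStationary; transition;
      firstPassage; IsMeanFirstPassageTime; kemeny)
  open WeightedGraph G
  open Limits R
  open ≤-Reasoning

  Δ≈ : ∀ u x → Δ u x ≈ deg x * u x - ∑ λ y → weight x y * u y
  Δ≈ u x = begin-equality
    (∑ λ y → weight x y * (u x - u y))
      ≈⟨ ∑-cong (λ y → solve 3 (λ w a b → w :* (a :- b) := w :* a :- w :* b)
          refl (weight x y) (u x) (u y)) ⟩
    (∑ λ y → weight x y * u x - weight x y * u y)             ≈⟨ ∑-distrib-- _ _ ⟩
    (∑ λ y → weight x y * u x) - (∑ λ y → weight x y * u y)
      ≈⟨ +-congʳ (trans (sym (*-distribʳ-∑ _ _)) (*-congʳ (sym (deg≈∑ x)))) ⟩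
    deg x * u x - (∑ λ y → weight x y * u y) ∎

  P : Fin n → Fin n → Carrier
  P = transition G

  module Recurrent (0<deg : ∀ i → 0# < deg i) where

    deg*P : ∀ x y → deg x * P x y ≈ weight x y
    deg*P x y = x*[y/x] (weight x y) (0<deg x)

    P-nonNeg : ∀ x y → 0# ≤ P x y
    P-nonNeg x y = *-nonNeg (nonNeg x y) (proj₁ (⁻¹-pos (0<deg x)))

    P-row : ∀ x → ∑ (P x) ≈ 1#
    P-row x = begin-equality
      ∑ (P x)                       ≈⟨ *-distribʳ-∑ (deg x ⁻¹) (weight x) ⟨
      ∑ (weight x) / deg x          ≈⟨ *-congʳ (sym (deg≈∑ x)) ⟩
      deg x / deg x                 ≈⟨ ⁻¹-inverseʳ (pos⇒≉0 (0<deg x)) ⟩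
      1#                            ∎

    module Target (i : Fin n) where

      -- The walk killed on arrival at `i`. Columns are masked and not rows, so a walk that starts
      -- at `i` still makes a step, as return times require.
      Q : Fin n → Fin n → Carrier
      Q x y = χ (∁ ⁅ i ⁆) y * P x y

      -- On mean first passage times this yields mean hitting times: the two agree except at `i`,
      -- where the return time is replaced by zero.
      kill : Vector Carrier n → Vector Carrier n
      kill u x = χ (∁ ⁅ i ⁆) x * u x

      kill≈ : ∀ u x → kill u x ≈ u x - χ ⁅ i ⁆ x * u i
      kill≈ u x = begin-equality
        χ (∁ ⁅ i ⁆) x * u x            ≈⟨ *-congʳ (χ-∁ ⁅ i ⁆ x) ⟩
        (1# - χ ⁅ i ⁆ x) * u x
          ≈⟨ solve 2 (λ d a → (:1 :- d) :* a := a :- d :* a) refl (χ ⁅ i ⁆ x) (u x) ⟩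
        u x - χ ⁅ i ⁆ x * u x          ≈⟨ +-congˡ (-‿cong (χ⁅⁆-* i u x)) ⟩
        u x - χ ⁅ i ⁆ x * u i          ∎

      kill-target : ∀ u → kill u i ≈ 0#
      kill-target u = trans (*-congʳ (χ-∉ (x∈p⇒x∉∁p (x∈⁅x⁆ i)))) (zeroˡ _)

      -- Masking column `y` of `P` amounts to masking the value at `y`, so `apply Q u` is `P`
      -- applied to `kill u`, and the identity is `Δ = D (I - P)`.
      Δ-kill : ∀ u x → Δ (kill u) x ≈ deg x * (kill u x - apply Q u x)
      Δ-kill u x = begin-equality
        Δ (kill u) x                                          ≈⟨ Δ≈ (kill u) x ⟩
        deg x * kill u x - (∑ λ y → weight x y * kill u y)
          ≈⟨ +-congˡ (-‿cong (∑-cong λ y → trans (*-congʳ (sym (deg*P x y)))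
              (solve 4 (λ d p e a → d :* p :* (e :* a) := d :* (e :* p :* a))
                  refl (deg x) (P x y) (χ (∁ ⁅ i ⁆) y) (u y)))) ⟩
        deg x * kill u x - (∑ λ y → deg x * (Q x y * u y))
          ≈⟨ +-congˡ (-‿cong (sym (*-distribˡ-∑ _ _))) ⟩
        deg x * kill u x - deg x * apply Q u x
          ≈⟨ solve 3 (λ d a b → d :* a :- d :* b := d :* (a :- b))
              refl (deg x) (kill u x) (apply Q u x) ⟩
        deg x * (kill u x - apply Q u x)                      ∎

      P+Q-row : ∀ x → P x i + ∑ (Q x) ≈ 1#
      P+Q-row x = begin-equality
        P x i + ∑ (Q x)
          ≈⟨ +-congˡ (∑-cong λ y → trans (*-congʳ (χ-∁ ⁅ i ⁆ y))
              (solve 2 (λ d p → (:1 :- d) :* p := p :- d :* p) refl (χ ⁅ i ⁆ y) (P x y))) ⟩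
        P x i + (∑ λ y → P x y - χ ⁅ i ⁆ y * P x y)
          ≈⟨ +-congˡ (trans (∑-distrib-- _ _) (+-cong (P-row x) (-‿cong (χ⁅⁆-∑ i (P x))))) ⟩
        P x i + (1# - P x i)
          ≈⟨ solve 1 (λ p → p :+ (:1 :- p) := :1) refl (P x i) ⟩
        1# ∎

      -- For such a `z`, `Δ (kill z)` vanishes away from `i`, while `kill z` itself vanishes at `i`;
      -- so `kill z` has zero energy. It is therefore constant, with value 0 taken at `i`, and `z`
      -- is its average under `P`.
      Q-fixed⇒0 : ∀ z → (∀ x → z x ≈ apply Q z x) → ∀ x → z x ≈ 0#
      Q-fixed⇒0 z fixed x = begin-equality
        z x                         ≈⟨ fixed x ⟩
        (∑ λ y → Q x y * z y)
          ≈⟨ ∑-zero (λ y → trans (solve 3 (λ e p a → e :* p :* a := p :* (e :* a))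
              refl (χ (∁ ⁅ i ⁆) y) (P x y) (z y))
                  (trans (*-congˡ (trans (constant y i) (kill-target z))) (zeroʳ _))) ⟩
        0#                          ∎
        where
        constant : ∀ x y → kill z x ≈ kill z y
        constant = E≈0⇒constant (kill z) $ ∑-zero λ x → begin-equality
          kill z x * Δ (kill z) x
            ≈⟨ *-congˡ (trans (Δ-kill z x) (*-congˡ (+-congˡ (-‿cong (sym (fixed x)))))) ⟩
          χ (∁ ⁅ i ⁆) x * z x * (deg x * (χ (∁ ⁅ i ⁆) x * z x - z x))
            ≈⟨ solve 3 (λ e a d → e :* a :* (d :* (e :* a :- a)) := (e :* e :- e) :* (a :* a :* d))
                refl (χ (∁ ⁅ i ⁆) x) (z x) (deg x) ⟩
          (χ (∁ ⁅ i ⁆) x * χ (∁ ⁅ i ⁆) x - χ (∁ ⁅ i ⁆) x) * (z x * z x * deg x)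
            ≈⟨ trans (*-congʳ (≈⇒diff≈0 (χ-idem (∁ ⁅ i ⁆) x))) (zeroˡ _) ⟩
          0# ∎

      module _ {μ : Vector Carrier n} (μ-mean : ∀ j → IsMeanFirstPassageTime G j i (μ j)) where

        private
          f : ℕ → Vector Carrier n
          f t j = firstPassage G t j i

          f-suc : ∀ t j → f (suc (suc t)) j ≈ apply Q (f (suc t)) j
          f-suc t j = trans (sumOver≈∑χ (∁ ⁅ i ⁆) _) (∑-cong λ k → sym (*-assoc _ _ _))

          open FirstStep Q (λ x y → *-nonNeg (χ-nonNeg (∁ ⁅ i ⁆) y) (P-nonNeg x y)) f (λ _ → refl) f-suc

        -- β μ-mean j is the probability of ever reaching i from j.
        passage-certain : ∀ j → β μ-mean j ≈ 1#
        passage-certain j = sym $ diff≈0⇒≈ $ Q-fixed⇒0 (λ j → 1# - β μ-mean j) fixed j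
          where
          -- The probability of never arriving obeys a first-step equation without a source: the
          -- immediate arrival `P x i` cancels.
          fixed : ∀ x → 1# - β μ-mean x ≈ apply Q (λ j → 1# - β μ-mean j) x
          fixed x = begin-equality
            1# - β μ-mean x
              ≈⟨ +-cong (sym (P+Q-row x)) (-‿cong (β-fixed μ-mean x)) ⟩
            P x i + ∑ (Q x) - (P x i + apply Q (β μ-mean) x)
              ≈⟨ solve 3 (λ p q b → p :+ q :- (p :+ b) := q :- b) refl (P x i) (∑ (Q x)) _ ⟩
            ∑ (Q x) - apply Q (β μ-mean) x                        ≈⟨ ∑-distrib-- _ _ ⟨
            (∑ λ y → Q x y - Q x y * β μ-mean y)
              ≈⟨ ∑-cong (λ y → solve 2 (λ q b → q :* (:1 :- b) := q :- q :* b)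
                  refl (Q x y) (β μ-mean y)) ⟨
            apply Q (λ j → 1# - β μ-mean j) x                     ∎

        -- The Poisson equation of the hitting times: each step costs 1, because `μ - apply Q μ` is
        -- the certain passage probability, and the return time corrects the value at the target.
        Δ-passage : ∀ x → Δ (kill μ) x ≈ deg x * (1# - χ ⁅ i ⁆ x * μ i)
        Δ-passage x = begin-equality
          Δ (kill μ) x                                             ≈⟨ Δ-kill μ x ⟩
          deg x * (kill μ x - apply Q μ x)
            ≈⟨ *-congˡ (+-congʳ (kill≈ μ x)) ⟩
          deg x * (μ x - χ ⁅ i ⁆ x * μ i - apply Q μ x)
            ≈⟨ *-congˡ (solve 3 (λ a b q → a :- b :- q := a :- q :- b) refl (μ x) _ _) ⟩
          deg x * (μ x - apply Q μ x - χ ⁅ i ⁆ x * μ i)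
            ≈⟨ *-congˡ (+-congʳ (passage-certain x)) ⟩
          deg x * (1# - χ ⁅ i ⁆ x * μ i) ∎

        -- Kac's formula. A Laplacian sums to zero over all vertices, since by symmetry of `E` the
        -- sum pairs the function with the Laplacian of a constant; `Δ-passage` turns this into the
        -- balance of source and return time.
        return-time : deg i * μ i ≈ ∑ deg
        return-time = sym $ diff≈0⇒≈ $ begin-equality
          ∑ deg - deg i * μ i
            ≈⟨ +-congˡ (-‿cong (χ⁅⁆-∑ i (λ x → deg x * μ i))) ⟨
          ∑ deg - (∑ λ x → χ ⁅ i ⁆ x * (deg x * μ i))              ≈⟨ ∑-distrib-- _ _ ⟨
          (∑ λ x → deg x - χ ⁅ i ⁆ x * (deg x * μ i))
            ≈⟨ ∑-cong (λ x → trans (solve 3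
                (λ d e m → d :- e :* (d :* m) := :1 :* (d :* (:1 :- e :* m)))
                    refl (deg x) (χ ⁅ i ⁆ x) (μ i)) (*-congˡ (sym (Δ-passage x)))) ⟩
          E (λ _ → 1#) (kill μ)                                    ≈⟨ E-sym _ _ ⟩
          E (kill μ) (λ _ → 1#)
            ≈⟨ ∑-zero (λ x → trans (*-congˡ
                (∑-zero λ y → trans (*-congˡ (-‿inverseʳ 1#)) (zeroʳ _))) (zeroʳ _)) ⟩
          0#                                                       ∎

    module Stationary {π : Vector Carrier n} (stationary : IsStationary G π) where

      open IsStationary stationary

      ∑π : ∑ π ≈ 1#
      ∑π = trans (∑≈sum π) total

      -- By symmetry of the weights the walk is reversible, and invariance of `π` says that its
      -- density relative to the degrees is harmonic.
      density-constant : ∀ x y → π x / deg x ≈ π y / deg y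
      density-constant = harmonic⇒constant (λ x → π x / deg x) λ x → begin-equality
        Δ (λ x → π x / deg x) x                                          ≈⟨ Δ≈ _ x ⟩
        deg x * (π x / deg x) - (∑ λ y → weight x y * (π y / deg y))
          ≈⟨ +-cong (x*[y/x] (π x) (0<deg x))
              (-‿cong (∑-cong λ y → trans (*-congʳ (symmetric x y))
                  (solve 3 (λ w p d → w :* (p :* d) := p :* (w :* d))
                      refl (weight y x) (π y) (deg y ⁻¹)))) ⟩
        π x - (∑ λ y → π y * P y x)
          ≈⟨ ≈⇒diff≈0 (sym (trans (∑≈sum _) (invariant x))) ⟩
        0# ∎

      density : ∀ j x → π x ≈ π j / deg j * deg x
      density j x = begin-equality
        π x                        ≈⟨ x*[y/x] (π x) (0<deg x) ⟨
        deg x * (π x / deg x)      ≈⟨ trans (*-comm _ _) (*-congʳ (density-constant x j)) ⟩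
        π j / deg j * deg x        ∎

      density-total : ∀ j → π j / deg j * ∑ deg ≈ 1#
      density-total j = trans (*-distribˡ-∑ _ _) (trans (∑-cong (λ x → sym (density j x))) ∑π)

      module _ {μ : Fin n → Fin n → Carrier} (μ-mean : ∀ j i → IsMeanFirstPassageTime G j i (μ j i))
          (j : Fin n) where

        open Target using (kill; kill≈; kill-target)

        private
          ρ : Carrier
          ρ = π j / deg j

        toward : Fin n → Vector Carrier n
        toward i x = μ x i

        π*return : ∀ i → π i * μ i i ≈ 1#
        π*return i = begin-equality
          π i * μ i i              ≈⟨ *-congʳ (density j i) ⟩
          ρ * deg i * μ i i        ≈⟨ *-assoc _ _ _ ⟩
          ρ * (deg i * μ i i)      ≈⟨ *-congˡ (Target.return-time i (λ j → μ-mean j i)) ⟩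
          ρ * ∑ deg                ≈⟨ density-total j ⟩
          1#                       ∎

        -- The Green's function, normalized to vanish at its pole. The minus sign makes the pole at
        -- `i` positive, and since `π i * μ i i ≈ 1#` the factor `π i` scales it to `deg i`.
        γ : Fin n → Vector Carrier n
        γ i x = - (π i * kill i (toward i) x)

        Δγ : ∀ i x → Δ (γ i) x ≈ deg i * (χ ⁅ i ⁆ x - ρ * deg x)
        Δγ i x = begin-equality
          Δ (γ i) x
            ≈⟨ ∑-cong (λ y → solve 4 (λ w p a b → w :* (:- (p :* a) :- :- (p :* b)) :=
                :- p :* (w :* (a :- b))) refl (weight x y) (π i) _ _) ⟩
          (∑ λ y → - π i * (weight x y * (kill i (toward i) x - kill i (toward i) y)))
            ≈⟨ *-distribˡ-∑ _ _ ⟨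
          - π i * Δ (kill i (toward i)) x
            ≈⟨ *-congˡ (Target.Δ-passage i (λ j → μ-mean j i) x) ⟩
          - π i * (deg x * (1# - χ ⁅ i ⁆ x * μ i i))
            ≈⟨ solve 4 (λ p d e m → :- p :* (d :* (:1 :- e :* m)) := e :* d :* (p :* m) :- p :* d)
                refl (π i) (deg x) (χ ⁅ i ⁆ x) (μ i i) ⟩
          χ ⁅ i ⁆ x * deg x * (π i * μ i i) - π i * deg x
            ≈⟨ +-cong (trans (*-cong (χ⁅⁆-* i deg x) (π*return i)) (*-identityʳ _))
                (-‿cong (*-congʳ (density j i))) ⟩
          χ ⁅ i ⁆ x * deg i - ρ * deg i * deg x
            ≈⟨ solve 4 (λ e d r d′ → e :* d :- r :* d :* d′ := d :* (e :- r :* d′))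
                refl (χ ⁅ i ⁆ x) (deg i) ρ (deg x) ⟩
          deg i * (χ ⁅ i ⁆ x - ρ * deg x) ∎

        hitting : Vector Carrier n
        hitting x = ∑ λ i → π i * kill i (toward i) x

        -- The random target lemma. Averaged over a target drawn from `π`, the source `deg x` in
        -- `Δ-passage` is cancelled by the correction at target `x`, which is `π x * μ x x * deg x`.
        hitting-constant : ∀ x y → hitting x ≈ hitting y
        hitting-constant = harmonic⇒constant hitting λ x → begin-equality
          Δ hitting x                                                      ≈⟨ Δ-∑ π _ x ⟩
          (∑ λ i → π i * Δ (kill i (toward i)) x)
            ≈⟨ ∑-cong (λ i → *-congˡ (trans (Target.Δ-passage i (λ j → μ-mean j i) x)
                (*-congˡ (+-congˡ (-‿cong (*-congʳ (χ⁅⁆-sym i x))))))) ⟩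
          (∑ λ i → π i * (deg x * (1# - χ ⁅ x ⁆ i * μ i i)))
            ≈⟨ ∑-cong (λ i → solve 4 (λ p d e m → p :* (d :* (:1 :- e :* m)) := p :* d
                :- e :* (p :* m :* d)) refl (π i) (deg x) (χ ⁅ x ⁆ i) (μ i i)) ⟩
          (∑ λ i → π i * deg x - χ ⁅ x ⁆ i * (π i * μ i i * deg x))
            ≈⟨ trans (∑-distrib-- _ _) (+-cong (sym (*-distribʳ-∑ _ _)) (-‿cong (χ⁅⁆-∑ x _))) ⟩
          ∑ π * deg x - π x * μ x x * deg x
            ≈⟨ ≈⇒diff≈0 (*-congʳ (trans ∑π (sym (π*return x)))) ⟩
          0# ∎

        -- Going from passage to hitting times drops the return term `π j * μ j j ≈ 1#`, and this is
        -- the 1 subtracted in `kemeny`.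
        kemeny≈hitting : kemeny π μ j ≈ hitting j
        kemeny≈hitting = sym $ begin-equality
          (∑ λ i → π i * kill i (toward i) j)
            ≈⟨ ∑-cong (λ i → *-congˡ (trans (kill≈ i (toward i) j)
                (+-congˡ (-‿cong (*-congʳ (χ⁅⁆-sym i j)))))) ⟩
          (∑ λ i → π i * (μ j i - χ ⁅ j ⁆ i * μ i i))
            ≈⟨ ∑-cong (λ i → solve 4 (λ p a e m → p :* (a :- e :* m) := p :* a :- e :* (p :* m))
                refl (π i) (μ j i) (χ ⁅ j ⁆ i) (μ i i)) ⟩
          (∑ λ i → π i * μ j i - χ ⁅ j ⁆ i * (π i * μ i i))
            ≈⟨ trans (∑-distrib-- _ _) (+-cong (∑≈sum _) (-‿cong (trans (χ⁅⁆-∑ j _) (π*return j)))) ⟩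
          kemeny π μ j ∎

        open PartitionEnergy.Potential R G 0<deg ρ (density-total j) γ Δγ public using
            (greenEnergy; greenEnergy-bound)
        open PartitionEnergy.Potential R G 0<deg ρ (density-total j) γ Δγ using (Γ-⁅⁆)

        -- Dividing `E (γ i) (γ i)` by `deg i` pairs `γ i` with the indicator of `i` minus `π`. As
        -- `γ i` vanishes at `i`, only its `π`-average survives; summing over `i` averages `hitting`
        -- over its starting vertex, and `hitting` is constant.
        greenEnergy≈kemeny : greenEnergy ⁅_⁆ ≈ kemeny π μ j
        greenEnergy≈kemeny = begin-equality
          greenEnergy ⁅_⁆
            ≈⟨ ∑-cong (λ i → *-cong (E-cong (Γ-⁅⁆ i)) (⁻¹-cong (vol-⁅⁆ i))) ⟩
          (∑ λ i → E (γ i) (γ i) / deg i)                                  ≈⟨ ∑-cong column ⟩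
          (∑ λ i → ∑ λ x → π x * (π i * kill i (toward i) x))              ≈⟨ ∑-swap _ ⟩
          (∑ λ x → ∑ λ i → π x * (π i * kill i (toward i) x))
            ≈⟨ ∑-cong (λ x → *-distribˡ-∑ _ _) ⟨
          (∑ λ x → π x * hitting x)
            ≈⟨ ∑-cong (λ x → *-congˡ (hitting-constant x j)) ⟩
          (∑ λ x → π x * hitting j)                                        ≈⟨ *-distribʳ-∑ _ _ ⟨
          ∑ π * hitting j
            ≈⟨ trans (*-congʳ ∑π) (*-identityˡ _) ⟩
          hitting j                                                        ≈⟨ kemeny≈hitting ⟨
          kemeny π μ j                                                   ∎
          where
          column : ∀ i → E (γ i) (γ i) / deg i ≈ ∑ λ x → π x * (π i * kill i (toward i) x)
          column i = begin-equality
            (∑ λ x → γ i x * Δ (γ i) x) / deg i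
              ≈⟨ *-distribʳ-∑ _ _ ⟩
            (∑ λ x → γ i x * Δ (γ i) x * deg i ⁻¹)                                  ≈⟨ ∑-cong term ⟩
            (∑ λ x → π x * (π i * kill i (toward i) x) + χ ⁅ i ⁆ x * γ i x)
              ≈⟨ trans (∑-distrib-+ _ _) (+-congˡ (χ⁅⁆-∑ i (γ i))) ⟩
            (∑ λ x → π x * (π i * kill i (toward i) x)) + - (π i * kill i (toward i) i)
              ≈⟨ +-congˡ (-‿cong (*-congˡ (kill-target i (toward i)))) ⟩
            (∑ λ x → π x * (π i * kill i (toward i) x)) + - (π i * 0#)
              ≈⟨ solve 2 (λ a p → a :+ :- (p :* :0) := a) refl _ (π i) ⟩
            (∑ λ x → π x * (π i * kill i (toward i) x)) ∎
            where
            term : ∀ x → γ i x * Δ (γ i) x * deg i ⁻¹ ≈ π x * (π i * kill i (toward i) x)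
                + χ ⁅ i ⁆ x * γ i x
            term x = begin-equality
              γ i x * Δ (γ i) x * deg i ⁻¹
                ≈⟨ *-congʳ (*-congˡ (Δγ i x)) ⟩
              γ i x * (deg i * (χ ⁅ i ⁆ x - ρ * deg x)) * deg i ⁻¹
                ≈⟨ solve 5 (λ g d e r d⁻¹ → g :* (d :* (e :- r)) :* d⁻¹ :=
                    g :* (e :- r) :* (d :* d⁻¹))
                        refl (γ i x) (deg i) (χ ⁅ i ⁆ x) (ρ * deg x) (deg i ⁻¹) ⟩
              γ i x * (χ ⁅ i ⁆ x - ρ * deg x) * (deg i * deg i ⁻¹)
                ≈⟨ trans (*-cong (*-congˡ (+-congˡ (-‿cong (sym (density j x)))))
                    (⁻¹-inverseʳ (pos⇒≉0 (0<deg i)))) (*-identityʳ _) ⟩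
              γ i x * (χ ⁅ i ⁆ x - π x)
                ≈⟨ solve 3 (λ h e p → :- h :* (e :- p) := p :* h :+ e :* :- h)
                    refl (π i * kill i (toward i) x) (χ ⁅ i ⁆ x) (π x) ⟩
              π x * (π i * kill i (toward i) x) + χ ⁅ i ⁆ x * γ i x ∎

-- Order of the natural numbers in the field.

module FromNat {ℓ ℓ₁ ℓ₂} (R : OrderedField ℓ ℓ₁ ℓ₂) where

  open OrderedFieldProperties R

  fromℕ-nonNeg : ∀ n → 0# ≤ fromℕ n
  fromℕ-nonNeg zero    = ≤-refl
  fromℕ-nonNeg (suc n) = +-nonNeg (proj₁ 0<1) (fromℕ-nonNeg n)

  fromℕ-mono-< : ∀ {m n} → m <ℕ n → 0# < fromℕ n - fromℕ m
  fromℕ-mono-< {zero}  {suc n} _ = <⇒0< (0<⇒< (+-pos-nonNeg 0<1 (fromℕ-nonNeg n)) (sym (+-identityˡ _)))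
  fromℕ-mono-< {suc m} {suc n} (s≤s m<n) = <⇒0< (0<⇒< (fromℕ-mono-< m<n)
    (solve 2 (λ m n → :1 :+ n := :1 :+ m :+ (n :- m)) refl (fromℕ m) (fromℕ n)))

proposition4p5 : ∀ {c ℓ₁ ℓ₂} (R : OrderedField c ℓ₁ ℓ₂) →
    let open OrderedField R
        open OverField R
    in
    (n m : ℕ) → 3 ≤ℕ n → 2 ≤ℕ m → m ≤ℕ n ∸ 1 →
    (G : WeightedGraph n) →
    (V : Fin m → Subset n) → IsPartition V →
    (π : Vector Carrier n) → IsStationary G π →
    (μ : Fin n → Fin n → Carrier) → (∀ j i → IsMeanFirstPassageTime G j i (μ j i)) →
    (j : Fin n) →
    F n m (NCut G V) ≤ kemeny π μ j
-- With the order written as a successor, `n ∸ 1` computes, and the upper bound on `m` becomes a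
-- strict inequality below the order.
proposition4p5 R (suc n) m (s≤s 2≤n) 2≤m m≤n G V partition π stationary μ μ-mean j = begin
  F (suc n) m (NCut G V)
    -- A square unfolds to `x * (x * 1#)`; only the trailing factor is removed.
    ≈⟨ +-cong (*-congʳ (*-congˡ (*-identityʳ _))) (*-congʳ (*-congˡ (*-identityʳ _))) ⟩
  p * p / NCut G V + q * q / (fromℕ (suc n) - NCut G V)
    ≤⟨ greenEnergy-bound stationary μ-mean j partition 0<p (fromℕ-mono-< (s≤s m≤n)) ⟩
  greenEnergy stationary μ-mean j ⁅_⁆
    ≈⟨ greenEnergy≈kemeny stationary μ-mean j ⟩
  kemeny π μ j ∎
  where
  open OrderedFieldProperties R
  open OverField R using (F; NCut; kemeny)
  open FromNat R
  open RandomWalk.Recurrent R G (Degrees.deg-pos R G (ℕ.m≤n⇒m≤1+n 2≤n))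
  open Stationary
  open ≤-Reasoning
  p = fromℕ m - 1#
  q = fromℕ (suc n) - fromℕ m
  0<p : 0# < p
  0<p = begin-strict
    0#                  <⟨ fromℕ-mono-< 2≤m ⟩
    fromℕ m - fromℕ 1   ≈⟨ +-congˡ (-‿cong (+-identityʳ 1#)) ⟩
    p                   ∎
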